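{- A minor-minimal non-splitting graph cannot have a cut vertex.
   Context: Graphs are finite undirected connected multigraphs, possibly with loops and parallel edges. A cut vertex of a connected graph $G$ is a vertex $v$ such that the graph induced by $V(G)-\{v\}$ is disconnected or trivial. Dodgson polynomials: assign a variable $\alpha_e$ to each edge $e$ of $G$. Orient the edges arbitrarily, let $\xi_G$ be the $|E(G)|\times|V(G)|$ incidence matrix with $(\xi_G)_{e,v}=1$ if $v$ is the source of $e$, $-1$ if $v$ is the target of $e$, and $0$ otherwise (the row of a loop is zero), let $\widehat\xi_G$ be $\xi_G$ with one arbitrary column deleted, and let $A$ be the diagonal matrix with entries $\alpha_e$. Put $$M_G=\begin{pmatrix}A&\widehat\xi_G\\-\widehat\xi_G^{\,T}&0\end{pmatrix}.$$ For $I,J,K\subseteq E(G)$ with $|I|=|J|$, the Dodgson polynomial $\Psi^{I,J}_K$ is the determinant of the matrix obtained from $M_G$ by deleting the rows indexed by $I$, deleting the columns indexed by $J$, and setting $\alpha_e=0$ for all $e\in K$; it is well defined up to sign. A $5$-configuration is a set $S\subseteq E(G)$ with $|S|=5$. $D_S$ is the set of (thirty) Dodgson polynomials $\Psi^{I,J}_K$ with $I\cup J\cup K=S$, $K$ disjoint from $I\cup J$, and either $|I|=|J|=2$, $I\cap J=\emptyset$, $|K|=1$, or $|I|=|J|=3$, $|I\cap J|=1$, $K=\emptyset$. The $5$-configuration $S$ splits if at least one $D\in D_S$ is the zero polynomial; otherwise $S$ is non-splitting. A graph splits if all of its $5$-configurations split; it is non-splitting if it has at least one non-splitting $5$-configuration.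 A non-splitting graph $G$ is minor-minimal non-splitting if for every $e\in E(G)$ both the deletion $G\setminus e$ and the contraction $G/e$ split. -}

module Defs where

open import Algebra.Bundles.Raw using (RawRing)
import Algebra.Definitions.RawMonoid as RawMonoidDefs
open import Data.Bool.Base using (if_then_else_)
open import Data.Fin.Base using (Fin; zero; suc; toℕ; punchIn; punchOut)
import Data.Fin.Base as Fin
open import Data.Fin.Properties using (_≟_)
open import Data.Fin.Subset
  using (Subset; inside; outside; _∈_; _∪_; _∩_; ∁; ⊤; ⁅_⁆; ∣_∣; Empty)
open import Data.Fin.Subset.Properties using (_∈?_; ∣∁p∣≡n∸∣p∣)
import Data.Integer.Base as ℤ
open import Data.Integer.Base using (ℤ; 0ℤ; 1ℤ)
open import Data.List.Base as List using (List; []; _∷_)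
open import Data.Nat.Base using (ℕ; zero; suc; pred; _+_; _∸_; _≤_)
open import Data.Product.Base using (Σ; ∃; _×_; _,_; proj₂)
open import Data.Sum.Base using (_⊎_; inj₁; inj₂)
open import Data.Vec.Base as Vec using (Vec; lookup; allFin)
open import Function.Base using (_∘_)
open import Level using (0ℓ)
open import Relation.Binary.Construct.Closure.ReflexiveTransitive using (Star)
open import Relation.Binary.PropositionalEquality
  using (_≡_; _≢_; sym; cong; module ≡-Reasoning)
open import Relation.Nullary using (¬_; Dec; yes; no; ⌊_⌋)

private
  variable
    n m : ℕ

------------------------------------------------------------------------
-- Polynomials

-- Univariate polynomials as coefficient lists, constant term first.
-- Trailing zeros are allowed, so equality compares coefficients.

module Univariate (R : RawRing 0ℓ 0ℓ) where
  private module R = RawRing R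

  coefficient : List R.Carrier → ℕ → R.Carrier
  coefficient []      _       = R.0#
  coefficient (a ∷ _) zero    = a
  coefficient (_ ∷ p) (suc i) = coefficient p i

  infixl 6 _⊕_
  infixl 7 _⊗_

  _⊕_ : List R.Carrier → List R.Carrier → List R.Carrier
  []      ⊕ q       = q
  (a ∷ p) ⊕ []      = a ∷ p
  (a ∷ p) ⊕ (b ∷ q) = (a R.+ b) ∷ (p ⊕ q)

  _⊗_ : List R.Carrier → List R.Carrier → List R.Carrier
  []      ⊗ q = []
  (a ∷ p) ⊗ q = List.map (a R.*_) q ⊕ (R.0# ∷ (p ⊗ q))

  rawRing : RawRing 0ℓ 0ℓ
  rawRing = record
    { Carrier = List R.Carrier
    ; _≈_     = λ p q → ∀ i → coefficient p i R.≈ coefficient q i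
    ; _+_     = _⊕_
    ; _*_     = _⊗_
    ; -_      = List.map R.-_
    ; 0#      = []
    ; 1#      = R.1# ∷ []
    }

-- ℤ[α₀, …, αₘ₋₁], as polynomials in α₀ over ℤ[α₁, …, αₘ₋₁].

polynomialRing : ℕ → RawRing 0ℓ 0ℓ
polynomialRing zero    = ℤ.+-*-rawRing
polynomialRing (suc m) = Univariate.rawRing (polynomialRing m)

Poly : ℕ → Set
Poly m = RawRing.Carrier (polynomialRing m)

IsZero : Poly m → Set
IsZero {m} p = let open RawRing (polynomialRing m) in p ≈ 0#

constant : ℤ → Poly m
constant {zero}  c = c
constant {suc m} c = constant {m} c ∷ []

α : Fin m → Poly m
α {suc m} zero    = constant {m} 0ℤ ∷ constant {m} 1ℤ ∷ []
α {suc m} (suc e) = α e ∷ []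

------------------------------------------------------------------------
-- Determinants, by expansion along the first row

module Determinant (R : RawRing 0ℓ 0ℓ) where
  open RawRing R
    renaming (_+_ to _+ᴿ_; _*_ to _*ᴿ_; -_ to -ᴿ_)
  open RawMonoidDefs +-rawMonoid using (sum)

  sign : ℕ → Carrier
  sign zero    = 1#
  sign (suc k) = -ᴿ sign k

  det : ∀ {k} → (Fin k → Fin k → Carrier) → Carrier
  det {zero}  M = 1#
  det {suc k} M =
    sum λ j → sign (toℕ j) *ᴿ
      (M zero j *ᴿ det λ i j′ → M (suc i) (punchIn j j′))

------------------------------------------------------------------------
-- Multigraphs

-- Graph n m has n + 1 vertices (so at least one) and m edges.  Loops
-- and parallel edges are allowed.  Edges carry the orientation used to
-- write down the incidence matrix; nothing else depends on it.

record Graph (n m : ℕ) : Set where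
  field
    source target : Fin m → Fin (suc n)

open Graph public

Joins : Graph n m → Fin m → Fin (suc n) → Fin (suc n) → Set
Joins G e u w =
  (source G e ≡ u × target G e ≡ w) ⊎ (source G e ≡ w × target G e ≡ u)

Adjacent[_,_] : Graph n m → Subset (suc n) → Fin (suc n) → Fin (suc n) → Set
Adjacent[ G , X ] u w = u ∈ X × w ∈ X × ∃ λ e → Joins G e u w

-- Connectedness of the subgraph induced by X.

InducedConnected : Graph n m → Subset (suc n) → Set
InducedConnected G X = ∀ {u w} → u ∈ X → w ∈ X → Star Adjacent[ G , X ] u w

Connected : Graph n m → Set
Connected G = InducedConnected G ⊤

-- A graph is trivial when it has at most one vertex.

IsCutVertex : Graph n m → Fin (suc n) → Set
IsCutVertex G v = ¬ InducedConnected G V-v ⊎ ∣ V-v ∣ ≤ 1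
  where V-v = ∁ ⁅ v ⁆

delete : Graph n m → Fin m → Graph n (pred m)
delete {m = suc m} G e = record
  { source = source G ∘ punchIn e
  ; target = target G ∘ punchIn e
  }

-- Sends t to the image of s; the other vertices keep their order.

identify : {s t : Fin (suc n)} → s ≢ t → Fin (suc n) → Fin n
identify {s = s} {t} s≢t v with t ≟ v
... | yes _  = punchOut (s≢t ∘ sym)
... | no t≢v = punchOut t≢v

-- Contracting a loop deletes it.  With a single vertex, every edge is a
-- loop.

contract : Graph n m → Fin m → ∃ λ n′ → Graph n′ (pred m)
contract {zero}  G e = zero , delete G e
contract {suc n} G e with source G e ≟ target G e
... | yes _  = suc n , delete G e
... | no s≢t = n , record
  { source = identify s≢t ∘ source (delete G e)
  ; target = identify s≢t ∘ target (delete G e)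
  }

------------------------------------------------------------------------
-- Dodgson polynomials

-- The two terms cancel when e is a loop.

incidence : Graph n m → Fin m → Fin (suc n) → ℤ
incidence G e v = [ source G e ≟ v ] ℤ.- [ target G e ≟ v ]
  where
  [_] : ∀ {A : Set} → Dec A → ℤ
  [ d ] = if ⌊ d ⌋ then 1ℤ else 0ℤ

-- The column deleted from the incidence matrix is that of vertex zero.

reducedIncidence : Graph n m → Fin m → Fin n → ℤ
reducedIncidence G e v = incidence G e (suc v)

-- The matrix M_G with α_e = 0 for e ∈ K.

graphMatrix : Graph n m → Subset m → Fin m ⊎ Fin n → Fin m ⊎ Fin n → Poly m
graphMatrix {m = m} G K (inj₁ e) (inj₁ f) with e ≟ f | e ∈? K
... | yes _ | no _ = α e
... | _     | _    = constant {m} 0ℤ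
graphMatrix {m = m} G K (inj₁ e) (inj₂ v) =
  constant {m} (reducedIncidence G e v)
graphMatrix {m = m} G K (inj₂ v) (inj₁ e) =
  constant {m} (ℤ.- reducedIncidence G e v)
graphMatrix {m = m} G K (inj₂ v) (inj₂ w) = constant {m} 0ℤ

-- The elements of a subset, in increasing order.

elements : (X : Subset m) → Vec (Fin m) ∣ X ∣
elements Vec.[]              = Vec.[]
elements (inside  Vec.∷ X) = zero Vec.∷ Vec.map suc (elements X)
elements (outside Vec.∷ X) = Vec.map suc (elements X)

-- The row (or column) indices of M_G that remain after deleting X.

remaining : (X : Subset m) → Vec (Fin m ⊎ Fin n) (∣ ∁ X ∣ + n)
remaining {n = n} X =
  Vec.map inj₁ (elements (∁ X)) Vec.++ Vec.map inj₂ (allFin n)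

remaining-square : (I J : Subset m) → ∣ I ∣ ≡ ∣ J ∣ → ∣ ∁ I ∣ + n ≡ ∣ ∁ J ∣ + n
remaining-square {m} {n} I J eq = cong (_+ n) (begin
  ∣ ∁ I ∣    ≡⟨ ∣∁p∣≡n∸∣p∣ I ⟩
  m ∸ ∣ I ∣  ≡⟨ cong (m ∸_) eq ⟩
  m ∸ ∣ J ∣  ≡⟨ ∣∁p∣≡n∸∣p∣ J ⟨
  ∣ ∁ J ∣    ∎)
  where open ≡-Reasoning

dodgson : Graph n m → (I J K : Subset m) → ∣ I ∣ ≡ ∣ J ∣ → Poly m
dodgson {m = m} G I J K eq =
  det λ i j → graphMatrix G K (lookup (remaining I) i)
                (lookup (remaining J) (Fin.cast (remaining-square I J eq) j))
  where open Determinant (polynomialRing m)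

------------------------------------------------------------------------
-- Splitting

-- The triples (I, J, K) indexing the polynomials in D_S.

record DodgsonTriple (S I J K : Subset m) : Set where
  field
    union    : I ∪ J ∪ K ≡ S
    disjoint : Empty (K ∩ (I ∪ J))
    balanced : ∣ I ∣ ≡ ∣ J ∣
    shape    : (∣ I ∣ ≡ 2 × Empty (I ∩ J) × ∣ K ∣ ≡ 1)
             ⊎ (∣ I ∣ ≡ 3 × ∣ I ∩ J ∣ ≡ 1 × Empty K)

ConfigurationSplits : Graph n m → Subset m → Set
ConfigurationSplits {m = m} G S =
  ∃ λ I → ∃ λ J → ∃ λ K → Σ (DodgsonTriple S I J K) λ D →
    IsZero {m} (dodgson G I J K (DodgsonTriple.balanced D))

Splits : Graph n m → Set
Splits G = ∀ S → ∣ S ∣ ≡ 5 → ConfigurationSplits G S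

NonSplitting : Graph n m → Set
NonSplitting G = ∃ λ S → ∣ S ∣ ≡ 5 × ¬ ConfigurationSplits G S

MinorMinimalNonSplitting : Graph n m → Set
MinorMinimalNonSplitting G =
  NonSplitting G × (∀ e → Splits (delete G e) × Splits (proj₂ (contract G e)))

{-# OPTIONS --safe #-}
module Submission where

-- Substituting integers x for the variables, Ψ^{I,J}_K vanishes identically if
-- and only if for every x its matrix has a nonzero integer kernel vector.  Such
-- a vector consists of currents through the edges and potentials at the vertices
-- of an electrical network: currents vanish on J, Ohm's law with resistances x
-- (0 on K) holds off I, and currents are conserved at every vertex.
--
-- Let v be a cut vertex and S a 5-configuration.  If G − v is trivial, any two
-- edges of S carry a nonzero conserved current, so S splits.  Otherwise G is the
-- union of two sides meeting in v.  If S meets both sides, choose I to meet both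
-- and J to lie in one: on the other side there are more unknowns than equations,
-- so Ψ^{I,J}_K = 0.  If S lies in one side, the other side has a nonloop e, and
-- G / e splits at S.  Solutions on G / e are solutions on G with x_e = 0; if the
-- resistances on the side of e are nonnegative, the energy Σ x a² dissipated
-- there is zero, so the currents on that side may be dropped.  The result is a
-- solution for arbitrary x, and G splits at S with the same I, J and K.

open import Defs
open import Algebra.Bundles.Raw using (RawRing)
import Algebra.Definitions.RawMonoid as RawMonoidDefs
open import Data.Bool.Base using (Bool; true; false; not; if_then_else_; _∧_; _∨_)
import Data.Bool.Properties as Bool
open import Data.Empty using (⊥)
open import Data.Fin.Base
  using (Fin; zero; suc; toℕ; punchIn; punchOut; _↑ˡ_; _↑ʳ_; cast; splitAt)
open import Data.Fin.Properties
  using ( _≟_; any?; sequence; suc-injective; cast-is-id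
        ; punchInᵢ≢i; punchIn-punchOut; punchOut-punchIn; punchOut-cong; punchOut-injective
        ; splitAt-↑ˡ; splitAt-↑ʳ; splitAt⁻¹-↑ˡ; splitAt⁻¹-↑ʳ)
open import Data.Fin.Subset
  using (Subset; inside; outside; _∈_; _∉_; ∁; ∣_∣; _∪_; _∩_; ⁅_⁆; Empty)
  renaming (⊤ to full; _-_ to _∖_)
open import Data.Fin.Subset.Properties
open import Data.Integer.Base
  using (ℤ; +_; 0ℤ; 1ℤ; _+_; _*_; -_; _-_; _≤_)
import Data.Integer.Base as ℤ
import Data.Integer.Divisibility.Signed as Signed
open import Data.Integer.Properties hiding (_≟_)
import Data.Integer.Properties as ℤ
open import Data.Integer.Tactic.RingSolver using (solve-∀)
open import Data.List.Base as List using (List; []; _∷_)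
open import Data.Nat.Base as ℕ using (ℕ; zero; suc; z≤n)
import Data.Nat.Divisibility as ℕ
import Data.Nat.Properties as ℕ
open import Data.Product.Base using (∃; ∃₂; _×_; _,_; proj₁; proj₂)
open import Data.Sum.Base using (_⊎_; inj₁; inj₂; [_,_])
open import Data.Unit.Base using (⊤; tt)
open import Data.Vec.Base as Vec using (lookup; []; _∷_; here; there; allFin)
import Data.Vec.Functional as Vector
import Data.Vec.Functional.Properties as Vector
import Data.Vec.Properties as Vec
open import Effect.Monad using (RawMonad)
open import Function.Base using (_∘_; case_of_)
open import Relation.Binary.Construct.Closure.ReflexiveTransitive using (Star; ε; _◅_; _◅◅_)
open import Relation.Binary.PropositionalEquality
  using (_≡_; _≢_; refl; sym; ≢-sym; trans; cong; cong₂; subst; module ≡-Reasoning)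
open import Relation.Nullary using (¬_; Dec; yes; no; contradiction; ¬?; ⌊_⌋; does)
open import Relation.Nullary.Decidable using (_×-dec_; decidable-stable; ¬¬-excluded-middle)
open import Relation.Nullary.Negation using (¬¬-Monad)

import Algebra.Properties.Semiring.Sum +-*-semiring as Σ

open Determinant ℤ.+-*-rawRing using (sign; det)

private
  variable
    k l m n : ℕ

-- Evaluation of polynomials at integer points

horner : ℤ → List ℤ → ℤ
horner x []      = 0ℤ
horner x (c ∷ p) = c + x * horner x p

eval : (Fin m → ℤ) → Poly m → ℤ
eval {zero}  x c = c
eval {suc m} x p = horner (x zero) (List.map (eval (x ∘ suc)) p)

private
  module Ring m = RawRing (polynomialRing m)
  module Det m = Determinant (polynomialRing m)

eval-0 : (x : Fin m → ℤ) → eval x (Ring.0# m) ≡ 0ℤ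
eval-0 {zero}  x = refl
eval-0 {suc m} x = refl

eval-1 : (x : Fin m → ℤ) → eval x (Ring.1# m) ≡ 1ℤ
eval-1 {zero}  x = refl
eval-1 {suc m} x
  rewrite eval-1 (x ∘ suc) | *-zeroʳ (x zero) = refl

eval-constant : (x : Fin m → ℤ) (c : ℤ) → eval x (constant {m} c) ≡ c
eval-constant {zero}  x c = refl
eval-constant {suc m} x c
  rewrite eval-constant (x ∘ suc) c | *-zeroʳ (x zero) = +-identityʳ c

eval-α : (x : Fin m → ℤ) (e : Fin m) → eval x (α e) ≡ x e
eval-α {suc m} x zero
  rewrite eval-constant (x ∘ suc) 0ℤ | eval-constant (x ∘ suc) 1ℤ
    = lemma (x zero)
  where
  lemma : ∀ a → 0ℤ + a * (1ℤ + a * 0ℤ) ≡ a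
  lemma = solve-∀
eval-α {suc m} x (suc e)
  rewrite eval-α (x ∘ suc) e | *-zeroʳ (x zero) = +-identityʳ (x (suc e))

eval-neg : (x : Fin m → ℤ) (p : Poly m) → eval x (Ring.-_ m p) ≡ - eval x p
eval-neg {zero}  x p = refl
eval-neg {suc m} x []      = refl
eval-neg {suc m} x (a ∷ p)
  rewrite eval-neg (x ∘ suc) a | eval-neg {suc m} x p
    = lemma (x zero) (eval (x ∘ suc) a) (eval {suc m} x p)
  where
  lemma : ∀ t a b → - a + t * (- b) ≡ - (a + t * b)
  lemma = solve-∀

eval-+ : (x : Fin m → ℤ) (p q : Poly m) →
         eval x (Ring._+_ m p q) ≡ eval x p + eval x q
eval-+ {zero}  x p q = refl
eval-+ {suc m} x []      q       = sym (+-identityˡ _)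
eval-+ {suc m} x (a ∷ p) []      = sym (+-identityʳ _)
eval-+ {suc m} x (a ∷ p) (b ∷ q)
  rewrite eval-+ (x ∘ suc) a b | eval-+ {suc m} x p q
    = lemma (x zero) (eval (x ∘ suc) a) (eval (x ∘ suc) b)
        (eval {suc m} x p) (eval {suc m} x q)
  where
  lemma : ∀ t a b p q → a + b + t * (p + q) ≡ a + t * p + (b + t * q)
  lemma = solve-∀

eval-* : (x : Fin m → ℤ) (p q : Poly m) →
         eval x (Ring._*_ m p q) ≡ eval x p * eval x q
eval-scale : (x : Fin (suc m) → ℤ) (a : Poly m) (q : Poly (suc m)) →
             eval {suc m} x (List.map (Ring._*_ m a) q)
             ≡ eval (x ∘ suc) a * eval {suc m} x q

eval-* {zero}  x p q = refl
eval-* {suc m} x []      q = refl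
eval-* {suc m} x (a ∷ p) q
  rewrite eval-+ {suc m} x (List.map (Ring._*_ m a) q)
            (Ring.0# m ∷ Ring._*_ (suc m) p q)
        | eval-scale x a q | eval-0 (x ∘ suc) | eval-* {suc m} x p q
    = lemma (x zero) (eval (x ∘ suc) a) (eval {suc m} x p) (eval {suc m} x q)
  where
  lemma : ∀ t a p q → a * q + (0ℤ + t * (p * q)) ≡ (a + t * p) * q
  lemma = solve-∀

eval-scale x a []      = sym (*-zeroʳ (eval (x ∘ suc) a))
eval-scale x a (b ∷ q)
  rewrite eval-* (x ∘ suc) a b | eval-scale x a q
    = lemma (x zero) (eval (x ∘ suc) a) (eval (x ∘ suc) b) (eval x q)
  where
  lemma : ∀ t a b q → a * b + t * (a * q) ≡ a * (b + t * q)
  lemma = solve-∀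

eval-isZero : (x : Fin m → ℤ) (p : Poly m) → IsZero {m} p → eval x p ≡ 0ℤ
eval-isZero {zero}  x p       p≈0 = p≈0
eval-isZero {suc m} x []      p≈0 = refl
eval-isZero {suc m} x (a ∷ p) p≈0
  rewrite eval-isZero (x ∘ suc) a (p≈0 zero)
        | eval-isZero {suc m} x p (p≈0 ∘ suc)
        | *-zeroʳ (x zero) = refl

-- Evaluated at ∣c∣ + 1, the polynomial c + t q(t) vanishes only if ∣c∣ + 1
-- divides c, so its constant term c is zero.
horner-vanishing : ∀ p → (∀ k → horner (+ suc k) p ≡ 0ℤ) →
                   ∀ i → Univariate.coefficient ℤ.+-*-rawRing p i ≡ 0ℤ
horner-vanishing []      p≡0 i = refl
horner-vanishing (c ∷ p) p≡0 = λ where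
    zero    → c≡0
    (suc i) → horner-vanishing p q≡0 i
  where
  c≡-tq : ∀ k → c ≡ (- horner (+ suc k) p) * + suc k
  c≡-tq k = trans (lemma c (+ suc k) (horner (+ suc k) p))
    (trans (cong (_+ (- horner (+ suc k) p) * + suc k) (p≡0 k)) (+-identityˡ _))
    where
    lemma : ∀ c t h → c ≡ (c + t * h) + (- h) * t
    lemma = solve-∀
  c≡0 : c ≡ 0ℤ
  c≡0 = ∣i∣≡0⇒i≡0 (small ℤ.∣ c ∣ (Signed.∣⇒∣ᵤ {+ suc ℤ.∣ c ∣} {c}
    (Signed.divides (- horner (+ suc ℤ.∣ c ∣) p) (c≡-tq ℤ.∣ c ∣))))
    where
    small : ∀ k → suc k ℕ.∣ k → k ≡ 0
    small zero    _ = refl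
    small (suc k) d = contradiction d (ℕ.>⇒∤ (ℕ.n<1+n (suc k)))
  -- With c = 0 the value is t q(t), and t = k + 1 is nonzero, so q vanishes at the same points.
  q≡0 : ∀ k → horner (+ suc k) p ≡ 0ℤ
  q≡0 k with i*j≡0⇒i≡0∨j≡0 (+ suc k)
               (trans (sym (trans (cong (_+ + suc k * horner (+ suc k) p) c≡0)
                                  (+-identityˡ _))) (p≡0 k))
  ... | inj₂ eq = eq

-- With the other variables fixed at x, p is a polynomial in α₀ vanishing at all positive integers.
-- So each of its coefficients vanishes at every x, and induction applies to the coefficients.
isZero-eval : (p : Poly m) → (∀ x → eval {m} x p ≡ 0ℤ) → IsZero {m} p
isZero-eval {zero}  p p≡0 = p≡0 λ ()
isZero-eval {suc m} p p≡0 i = isZero-eval {m} (coeff p i) λ x →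
    trans (eval-coeff x p i) (horner-vanishing (List.map (eval x) p)
      (λ k → p≡0 λ { zero → + suc k ; (suc e) → x e }) i)
  where
  coeff = Univariate.coefficient (polynomialRing m)
  eval-coeff : ∀ x p i → eval {m} x (coeff p i)
               ≡ Univariate.coefficient ℤ.+-*-rawRing (List.map (eval x) p) i
  eval-coeff x []      i       = eval-0 x
  eval-coeff x (a ∷ p) zero    = refl
  eval-coeff x (a ∷ p) (suc i) = eval-coeff x p i

eval-det : ∀ {k} (x : Fin m → ℤ) (M : Fin k → Fin k → Poly m) →
           eval x (Det.det m M) ≡ det λ i j → eval x (M i j)
eval-det {k = zero}  x M = eval-1 x
eval-det {m} {k = suc k} x M = trans (eval-sum term) (Σ.sum-cong-≗ λ j → begin
  eval x (term j)
    ≡⟨ eval-* x (Det.sign m (toℕ j)) (Ring._*_ m (M zero j) (minor j)) ⟩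
  eval x (Det.sign m (toℕ j)) * eval x (Ring._*_ m (M zero j) (minor j))
    ≡⟨ cong₂ _*_ (eval-sign (toℕ j)) (eval-* x (M zero j) (minor j)) ⟩
  sign (toℕ j) * (eval x (M zero j) * eval x (minor j))
    ≡⟨ cong (λ d → sign (toℕ j) * (eval x (M zero j) * d))
         (eval-det x λ i j′ → M (suc i) (punchIn j j′)) ⟩
  sign (toℕ j) * (eval x (M zero j)
    * det (λ i j′ → eval x (M (suc i) (punchIn j j′)))) ∎)
  where
  open ≡-Reasoning
  open RawMonoidDefs (RawRing.+-rawMonoid (polynomialRing m)) using (sum)
  minor term : Fin (suc k) → Poly m
  minor j = Det.det m λ i j′ → M (suc i) (punchIn j j′)
  term j = Ring._*_ m (Det.sign m (toℕ j)) (Ring._*_ m (M zero j) (minor j))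
  eval-sum : ∀ {l} (t : Fin l → Poly m) →
             eval x (sum t) ≡ Σ.sum λ i → eval x (t i)
  eval-sum {zero}  t = eval-0 x
  eval-sum {suc l} t = trans (eval-+ x (t zero) (sum (t ∘ suc)))
                         (cong (_+_ (eval x (t zero))) (eval-sum (t ∘ suc)))
  eval-sign : ∀ l → eval x (Det.sign m l) ≡ sign l
  eval-sign zero    = eval-1 x
  eval-sign (suc l) = trans (eval-neg x (Det.sign m l)) (cong -_ (eval-sign l))

-- Determinants over ℤ

*-vanishʳ : ∀ i {j} → j ≡ 0ℤ → i * j ≡ 0ℤ
*-vanishʳ i refl = *-zeroʳ i

-- Opaque, so that an equation between sums determines the summands.

opaque
  ∑ : (Fin k → ℤ) → ℤ
  ∑ = Σ.sum

infixl 10 ∑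
syntax ∑ (λ i → t) = ∑[ i ] t

opaque
  unfolding ∑

  ∑-suc : (t : Fin (suc k) → ℤ) → ∑ t ≡ t zero + ∑[ i ] t (suc i)
  ∑-suc t = refl

  ∑-cong : {s t : Fin k → ℤ} → (∀ i → s i ≡ t i) → ∑ s ≡ ∑ t
  ∑-cong = Σ.sum-cong-≗

  ∑-zero : {t : Fin k → ℤ} → (∀ i → t i ≡ 0ℤ) → ∑ t ≡ 0ℤ
  ∑-zero {k} t≡0 = trans (Σ.sum-cong-≗ t≡0) (Σ.sum-replicate-zero k)

  ∑-distrib-+ : (s t : Fin k → ℤ) → ∑[ i ] (s i + t i) ≡ ∑ s + ∑ t
  ∑-distrib-+ = Σ.∑-distrib-+

  ∑-comm : (t : Fin k → Fin l → ℤ) → ∑[ i ] ∑[ j ] t i j ≡ ∑[ j ] ∑[ i ] t i j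
  ∑-comm = Σ.∑-comm

  ∑-distribˡ-* : (x : ℤ) (t : Fin k → ℤ) → x * ∑ t ≡ ∑[ i ] (x * t i)
  ∑-distribˡ-* = Σ.*-distribˡ-sum

  ∑-distribʳ-* : (x : ℤ) (t : Fin k → ℤ) → ∑ t * x ≡ ∑[ i ] (t i * x)
  ∑-distribʳ-* = Σ.*-distribʳ-sum

  ∑-remove : (i : Fin (suc k)) (t : Fin (suc k) → ℤ) →
             ∑ t ≡ t i + ∑[ j ] t (punchIn i j)
  ∑-remove i t = Σ.sum-remove {i = i} t

∑-single : {t : Fin k → ℤ} (i : Fin k) → (∀ j → j ≢ i → t j ≡ 0ℤ) → ∑ t ≡ t i
∑-single {suc k} {t} i t≡0 =
  trans (∑-remove i t)
    (trans (cong (_+_ (t i)) (∑-zero λ j → t≡0 (punchIn i j) (punchInᵢ≢i i j)))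
           (+-identityʳ (t i)))

∑-neg : (t : Fin k → ℤ) → ∑[ i ] (- t i) ≡ - ∑ t
∑-neg t = begin
  ∑[ i ] (- t i)         ≡⟨ ∑-cong (λ i → sym (-1*i≡-i (t i))) ⟩
  ∑[ i ] (ℤ.-1ℤ * t i)   ≡⟨ ∑-distribˡ-* ℤ.-1ℤ t ⟨
  ℤ.-1ℤ * ∑ t            ≡⟨ -1*i≡-i (∑ t) ⟩
  - ∑ t                  ∎
  where open ≡-Reasoning

opaque
  unfolding ∑

  ∑-splitAt : ∀ k (t : Fin (k ℕ.+ l) → ℤ) →
              ∑ t ≡ ∑[ i ] t (i ↑ˡ l) + ∑[ j ] t (k ↑ʳ j)
  ∑-splitAt zero    t = sym (+-identityˡ _)
  ∑-splitAt (suc k) t = trans (cong (_+_ (t zero)) (∑-splitAt k (t ∘ suc)))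
    (sym (+-assoc (t zero) _ _))

-- Spelled like the bracket in `incidence`, so that `incidence G e z` unfolds to a difference of two
-- values of `δ`.
δ : Fin k → Fin k → ℤ
δ i j = if ⌊ i ≟ j ⌋ then 1ℤ else 0ℤ

δ-refl : (i : Fin k) → δ i i ≡ 1ℤ
δ-refl i with i ≟ i
... | yes _  = refl
... | no i≢i = contradiction refl i≢i

δ-≢ : {i j : Fin k} → i ≢ j → δ i j ≡ 0ℤ
δ-≢ {i = i} {j} i≢j with i ≟ j
... | yes i≡j = contradiction i≡j i≢j
... | no _    = refl

∑-δ : (i : Fin k) (t : Fin k → ℤ) → ∑[ j ] (δ i j * t j) ≡ t i
∑-δ i t = trans (∑-single i λ j j≢i → cong (_* t j) (δ-≢ (j≢i ∘ sym)))
  (trans (cong (_* t i) (δ-refl i)) (*-identityˡ (t i)))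

-- The signed maximal minors, or generalised cross product of the rows: these are the cofactors of
-- any row placed on top of N.
cofactor : (Fin k → Fin (suc k) → ℤ) → Fin (suc k) → ℤ
cofactor N j = sign (toℕ j) * det λ i j′ → N i (punchIn j j′)

opaque
  unfolding ∑

  det-laplace : (M : Fin (suc k) → Fin (suc k) → ℤ) →
                det M ≡ ∑[ j ] (M zero j * cofactor (M ∘ suc) j)
  det-laplace M = Σ.sum-cong-≗ λ j →
      lemma (sign (toℕ j)) (M zero j) (det λ i j′ → M (suc i) (punchIn j j′))
    where
    lemma : ∀ s a d → s * (a * d) ≡ a * (s * d)
    lemma = solve-∀

det-cong : {M N : Fin k → Fin k → ℤ} → (∀ i j → M i j ≡ N i j) → det M ≡ det N
det-cong {zero}  M≡N = refl
det-cong {suc k} M≡N = Σ.sum-cong-≗ λ j →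
  cong₂ (λ a d → sign (toℕ j) * (a * d)) (M≡N zero j)
    (det-cong λ i j′ → M≡N (suc i) (punchIn j j′))

-- Deleting the columns a and b in either order leaves the same columns,
-- but the two cofactor signs differ.

punchIn-comm : (a b : Fin (suc (suc k))) (a≢b : a ≢ b) (b≢a : b ≢ a) (x : Fin k) →
               punchIn a (punchIn (punchOut a≢b) x)
               ≡ punchIn b (punchIn (punchOut b≢a) x)
punchIn-comm zero    zero    a≢b b≢a x = contradiction refl a≢b
punchIn-comm zero    (suc b) a≢b b≢a x = refl
punchIn-comm (suc a) zero    a≢b b≢a x = refl
punchIn-comm {suc k} (suc a) (suc b) a≢b b≢a zero    = refl
punchIn-comm {suc k} (suc a) (suc b) a≢b b≢a (suc x) =
  cong suc (punchIn-comm a b (a≢b ∘ cong suc) (b≢a ∘ cong suc) x)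

sign-anticomm : (a b : Fin (suc k)) (a≢b : a ≢ b) (b≢a : b ≢ a) →
                sign (toℕ a) * sign (toℕ (punchOut a≢b))
                ≡ - (sign (toℕ b) * sign (toℕ (punchOut b≢a)))
sign-anticomm zero    zero    a≢b b≢a = contradiction refl a≢b
sign-anticomm {suc k} zero (suc b) a≢b b≢a = lemma (sign (toℕ b))
  where
  lemma : ∀ s → 1ℤ * s ≡ - (- s * 1ℤ)
  lemma = solve-∀
sign-anticomm {suc k} (suc a) zero a≢b b≢a = lemma (sign (toℕ a))
  where
  lemma : ∀ s → - s * 1ℤ ≡ - (1ℤ * s)
  lemma = solve-∀
sign-anticomm {suc k} (suc a) (suc b) a≢b b≢a =
  trans (lemma (sign (toℕ a)) _)
    (trans (sign-anticomm a b (a≢b ∘ cong suc) (b≢a ∘ cong suc))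
      (cong -_ (sym (lemma (sign (toℕ b)) _))))
  where
  lemma : ∀ s t → - s * - t ≡ s * t
  lemma = solve-∀

module _ (N : Fin k → Fin (suc (suc k)) → ℤ) where

  private
    pair : (a b : Fin (suc (suc k))) → a ≢ b → ℤ
    pair a b a≢b = sign (toℕ a) * sign (toℕ (punchOut a≢b))
                   * det λ i x → N i (punchIn a (punchIn (punchOut a≢b) x))

    -- The coefficient of r a * s b in the determinant with top rows r and s above N. The zeros on
    -- the diagonal let a and b range over all columns independently.
    twoColumns : (a b : Fin (suc (suc k))) → ℤ
    twoColumns a b with a ≟ b
    ... | yes _  = 0ℤ
    ... | no a≢b = pair a b a≢b

    twoColumns-diagonal : ∀ a → twoColumns a a ≡ 0ℤ
    twoColumns-diagonal a with a ≟ a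
    ... | yes _  = refl
    ... | no a≢a = contradiction refl a≢a

    twoColumns-anticomm : ∀ a b → twoColumns a b ≡ - twoColumns b a
    twoColumns-anticomm a b with a ≟ b | b ≟ a
    ... | yes _   | yes _   = refl
    ... | yes a≡b | no b≢a  = contradiction (sym a≡b) b≢a
    ... | no a≢b  | yes b≡a = contradiction (sym b≡a) a≢b
    ... | no a≢b  | no b≢a  =
      trans (cong₂ _*_ (sign-anticomm a b a≢b b≢a)
               (det-cong λ i x → cong (N i) (punchIn-comm a b a≢b b≢a x)))
        (sym (neg-distribˡ-* (sign (toℕ b) * _) _))

    twoColumns-punchIn : ∀ a l → twoColumns a (punchIn a l)
      ≡ sign (toℕ a) * cofactor (λ i x → N i (punchIn a x)) l
    twoColumns-punchIn a l with a ≟ punchIn a l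
    ... | yes eq = contradiction (sym eq) (punchInᵢ≢i a l)
    ... | no neq
      rewrite trans (punchOut-cong a {i≢j = neq} {i≢k = punchInᵢ≢i a l ∘ sym} refl)
                    (punchOut-punchIn a {l})
      = *-assoc (sign (toℕ a)) _ _

    -- Laplace expansion along both top rows. Column l of the inner minor is column `punchIn a l` of
    -- the whole matrix, and the missing column a is added with coefficient zero.
    expand : ∀ (r s : Fin (suc (suc k)) → ℤ) → ∑[ a ] (r a * cofactor (s Vector.∷ N) a)
           ≡ ∑[ a ] ∑[ b ] (r a * s b * twoColumns a b)
    expand r s = ∑-cong λ a → begin
      r a * cofactor (s Vector.∷ N) a
        ≡⟨ cong (λ d → r a * (sign (toℕ a) * d))
             (det-laplace λ i x → (s Vector.∷ N) i (punchIn a x)) ⟩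
      r a * (sign (toℕ a) * ∑[ l ] (s (punchIn a l) * cof a l))
        ≡⟨ *-assoc (r a) (sign (toℕ a)) _ ⟨
      r a * sign (toℕ a) * ∑[ l ] (s (punchIn a l) * cof a l)
        ≡⟨ ∑-distribˡ-* (r a * sign (toℕ a)) _ ⟩
      ∑[ l ] (r a * sign (toℕ a) * (s (punchIn a l) * cof a l))
        ≡⟨ ∑-cong (λ l → trans
             (lemma (r a) (sign (toℕ a)) (s (punchIn a l)) (cof a l))
             (cong (r a * s (punchIn a l) *_) (sym (twoColumns-punchIn a l)))) ⟩
      ∑[ l ] (r a * s (punchIn a l) * twoColumns a (punchIn a l))
        ≡⟨ +-identityˡ _ ⟨
      0ℤ + ∑[ l ] (r a * s (punchIn a l) * twoColumns a (punchIn a l))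
        ≡⟨ cong (_+ ∑[ l ] (r a * s (punchIn a l) * twoColumns a (punchIn a l)))
             (*-vanishʳ (r a * s a) (twoColumns-diagonal a)) ⟨
      r a * s a * twoColumns a a
        + ∑[ l ] (r a * s (punchIn a l) * twoColumns a (punchIn a l))
        ≡⟨ ∑-remove a (λ b → r a * s b * twoColumns a b) ⟨
      ∑[ b ] (r a * s b * twoColumns a b) ∎
      where
      open ≡-Reasoning
      cof : Fin (suc (suc k)) → Fin (suc k) → ℤ
      cof a = cofactor (λ i x → N i (punchIn a x))
      lemma : ∀ r t s c → r * t * (s * c) ≡ r * s * (t * c)
      lemma = solve-∀

  -- Exchanging the two top rows changes the sign of the determinant, because `twoColumns` is
  -- antisymmetric.
  cofactor-swap : ∀ (r s : Fin (suc (suc k)) → ℤ) → ∑[ a ] (r a * cofactor (s Vector.∷ N) a)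
                ≡ - ∑[ a ] (s a * cofactor (r Vector.∷ N) a)
  cofactor-swap r s = begin
    ∑[ a ] (r a * cofactor (s Vector.∷ N) a)
      ≡⟨ expand r s ⟩
    ∑[ a ] ∑[ b ] (r a * s b * twoColumns a b)
      ≡⟨ ∑-comm (λ a b → r a * s b * twoColumns a b) ⟩
    ∑[ b ] ∑[ a ] (r a * s b * twoColumns a b)
      ≡⟨ ∑-cong (λ b → trans (∑-cong λ a →
           trans (cong (r a * s b *_) (twoColumns-anticomm a b))
             (lemma (r a) (s b) (twoColumns b a)))
           (∑-neg λ a → s b * r a * twoColumns b a)) ⟩
    ∑[ b ] (- ∑[ a ] (s b * r a * twoColumns b a))
      ≡⟨ ∑-neg (λ b → ∑[ a ] (s b * r a * twoColumns b a)) ⟩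
    - ∑[ b ] ∑[ a ] (s b * r a * twoColumns b a)
      ≡⟨ cong -_ (expand s r) ⟨
    - ∑[ a ] (s a * cofactor (r Vector.∷ N) a) ∎
    where
    open ≡-Reasoning
    lemma : ∀ r s t → r * s * - t ≡ - (s * r * t)
    lemma = solve-∀

i≡-i⇒i≡0 : ∀ i → i ≡ - i → i ≡ 0ℤ
i≡-i⇒i≡0 (+ zero) eq = refl

-- The sum is a determinant in which row i occurs twice. If i is the first row, swapping the equal
-- rows shows that it is its own negative. Otherwise the two top rows are swapped, and the
-- repetition moves into the minors, which vanish by induction.
cofactor-orthogonal : (N : Fin k → Fin (suc k) → ℤ) (i : Fin k) →
                      ∑[ j ] (N i j * cofactor N j) ≡ 0ℤ
cofactor-orthogonal {suc k} N i = trans (∑-cong λ j → cong (N i j *_)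
    (cofactor-head j)) (go i)
  where
  s = N zero
  N′ = N ∘ suc
  cofactor-head : ∀ j → cofactor N j ≡ cofactor (s Vector.∷ N′) j
  cofactor-head j = cong (sign (toℕ j) *_) (det-cong λ i x → N≗ i (punchIn j x))
    where
    N≗ : ∀ i x → N i x ≡ (s Vector.∷ N′) i x
    N≗ zero    x = refl
    N≗ (suc i) x = refl
  go : ∀ i → ∑[ j ] (N i j * cofactor (s Vector.∷ N′) j) ≡ 0ℤ
  go zero    = i≡-i⇒i≡0 _ (cofactor-swap N′ s s)
  go (suc i₀) = trans (cofactor-swap N′ (N′ i₀) s)
    (cong -_ (∑-zero λ j → *-vanishʳ (s j) (*-vanishʳ (sign (toℕ j))
      (trans (det-laplace λ i x → (N′ i₀ Vector.∷ N′) i (punchIn j x))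
        (cofactor-orthogonal (λ i x → N′ i (punchIn j x)) i₀)))))

-- If u₀ = 0, the relation holds among the lower rows, so all minors along the first row vanish by
-- induction. If not, let c be the cofactors of the first row: the lower rows are orthogonal to c,
-- so u₀ det M = (u M) · c = 0.
det-leftKernel : (M : Fin k → Fin k → ℤ) (u : Fin k → ℤ) → (∃ λ i → u i ≢ 0ℤ) →
                 (∀ j → ∑[ i ] (u i * M i j) ≡ 0ℤ) → det M ≡ 0ℤ
det-leftKernel {suc k} M u (i , uᵢ≢0) uM≡0 with u zero ℤ.≟ 0ℤ
... | yes u₀≡0 = trans (det-laplace M) (∑-zero λ j →
        *-vanishʳ (M zero j) (*-vanishʳ (sign (toℕ j)) (minor≡0 i uᵢ≢0 j)))
  where
  minor≡0 : ∀ i → u i ≢ 0ℤ → ∀ j → det (λ i j′ → M (suc i) (punchIn j j′)) ≡ 0ℤ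
  minor≡0 zero    u₀≢0 j = contradiction u₀≡0 u₀≢0
  minor≡0 (suc i) uᵢ≢0 j = det-leftKernel _ (u ∘ suc) (i , uᵢ≢0) λ j′ →
    trans (sym (+-identityˡ _)) (trans
      (cong (_+ (∑[ i ] (u (suc i) * M (suc i) (punchIn j j′))))
        (sym (cong (_* M zero (punchIn j j′)) u₀≡0)))
      (trans (sym (∑-suc λ i → u i * M i (punchIn j j′))) (uM≡0 (punchIn j j′))))
... | no u₀≢0 with i*j≡0⇒i≡0∨j≡0 (u zero) u₀*det≡0
  where
  open ≡-Reasoning
  c = cofactor (M ∘ suc)
  u₀*det≡0 : u zero * det M ≡ 0ℤ
  u₀*det≡0 = begin
    u zero * det M
      ≡⟨ cong (u zero *_) (det-laplace M) ⟩
    u zero * ∑[ j ] (M zero j * c j)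
      ≡⟨ +-identityʳ _ ⟨
    u zero * (∑[ j ] (M zero j * c j)) + 0ℤ
      ≡⟨ cong (_+_ (u zero * (∑[ j ] (M zero j * c j)))) (∑-zero λ i →
           *-vanishʳ (u (suc i)) (cofactor-orthogonal (M ∘ suc) i)) ⟨
    u zero * ∑[ j ] (M zero j * c j) + ∑[ i ] (u (suc i) * ∑[ j ] (M (suc i) j * c j))
      ≡⟨ ∑-suc (λ i → u i * ∑[ j ] (M i j * c j)) ⟨
    ∑[ i ] (u i * ∑[ j ] (M i j * c j))
      ≡⟨ ∑-cong (λ i → trans (∑-distribˡ-* (u i) _)
           (∑-cong λ j → sym (*-assoc (u i) (M i j) (c j)))) ⟩
    ∑[ i ] ∑[ j ] (u i * M i j * c j)
      ≡⟨ ∑-comm (λ i j → u i * M i j * c j) ⟩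
    ∑[ j ] ∑[ i ] (u i * M i j * c j)
      ≡⟨ ∑-cong (λ j → sym (∑-distribʳ-* (c j) (λ i → u i * M i j))) ⟩
    ∑[ j ] (∑[ i ] (u i * M i j) * c j)
      ≡⟨ ∑-zero (λ j → cong (_* c j) (uM≡0 j)) ⟩
    0ℤ ∎
... | inj₁ u₀≡0 = contradiction u₀≡0 u₀≢0
... | inj₂ eq   = eq

-- Kernel vectors of integer matrices

HasKernel : (Fin l → Fin k → ℤ) → Set
HasKernel {k = k} M = ∃ λ (w : Fin k → ℤ) →
  (∃ λ j → w j ≢ 0ℤ) × (∀ i → ∑[ j ] (M i j * w j) ≡ 0ℤ)

-- If every maximal minor of N has a kernel, then N has two independent
-- kernel vectors, and a combination of them is orthogonal to any given row.

det≡0⇒kernel : (M : Fin k → Fin k → ℤ) → det M ≡ 0ℤ → HasKernel M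
det≡0⇒kernel {zero}  M ()
det≡0⇒kernel {suc k} M det≡0 with any? (λ j → ¬? (cofactor (M ∘ suc) j ℤ.≟ 0ℤ))
-- A nonzero cofactor vector is itself in the kernel: its product with the first row is det M, and
-- the lower rows are orthogonal to it.
... | yes nonzero = cofactor (M ∘ suc) , nonzero , λ where
        zero    → trans (sym (det-laplace M)) det≡0
        (suc i) → cofactor-orthogonal (M ∘ suc) i
... | no ¬nonzero = result
  where
  N = M ∘ suc
  minor : ∀ j → HasKernel (λ i j′ → N i (punchIn j j′))
  minor j = det≡0⇒kernel _ (decidable-stable (_ ℤ.≟ 0ℤ) λ d≢0 →
    ¬nonzero (j , λ c≡0 → case j d≢0 c≡0))
    where
    sign≢0 : ∀ n → sign n ≢ 0ℤ
    sign≢0 zero    ()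
    sign≢0 (suc n) eq = sign≢0 n (neg-injective eq)
    case : ∀ j {d} → d ≢ 0ℤ → sign (toℕ j) * d ≢ 0ℤ
    case j d≢0 eq with i*j≡0⇒i≡0∨j≡0 (sign (toℕ j)) eq
    ... | inj₁ s≡0 = sign≢0 (toℕ j) s≡0
    ... | inj₂ d≡0 = d≢0 d≡0
  kernelAvoiding : ∀ j → ∃ λ w → w j ≡ 0ℤ × (∃ λ l → w l ≢ 0ℤ) ×
                   ∀ i → ∑[ l ] (N i l * w l) ≡ 0ℤ
  kernelAvoiding j with minor j
  ... | w , (l , wₗ≢0) , Nw≡0 = w′ , Vector.insertAt-lookup w j 0ℤ
      , (punchIn j l , subst (_≢ 0ℤ) (sym (Vector.insertAt-punchIn w j 0ℤ l)) wₗ≢0)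
      , λ i → trans (∑-remove j (λ l → N i l * w′ l))
          (cong₂ _+_
            (*-vanishʳ (N i j) (Vector.insertAt-lookup w j 0ℤ))
            (trans (∑-cong λ l → cong (N i (punchIn j l) *_)
              (Vector.insertAt-punchIn w j 0ℤ l)) (Nw≡0 i)))
    where w′ = Vector.insertAt w j 0ℤ
  combine : (c d : ℤ) (w w′ r : Fin (suc k) → ℤ) →
            ∑[ l ] (r l * (c * w l + d * w′ l))
            ≡ c * (∑[ l ] (r l * w l)) + d * (∑[ l ] (r l * w′ l))
  combine c d w w′ r = trans
    (trans (∑-cong λ l → lemma c d (w l) (w′ l) (r l)) (∑-distrib-+ _ _))
    (cong₂ _+_ (sym (∑-distribˡ-* c _)) (sym (∑-distribˡ-* d _)))
    where
    lemma : ∀ c d w w′ r → r * (c * w + d * w′) ≡ c * (r * w) + d * (r * w′)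
    lemma = solve-∀
  result : HasKernel M
  result with kernelAvoiding zero
  ... | w , _ , (j , wⱼ≢0) , Nw≡0 with kernelAvoiding j
  ... | w′ , w′ⱼ≡0 , w′≢0 , Nw′≡0 with ∑[ l ] (M zero l * w′ l) in eq
  ... | b with b ℤ.≟ 0ℤ
  ... | yes refl = w′ , w′≢0 , λ { zero → eq ; (suc i) → Nw′≡0 i }
  -- The first row takes the values a at w and b at w′, so it annihilates b w - a w′. Since w′
  -- vanishes at j, the entry there is b wⱼ, which is nonzero.
  ... | no  b≢0  = (λ l → b * w l + (- a) * w′ l) , (j , nonzero) , λ where
        zero    → trans (combine b (- a) w w′ (M zero))
                    (trans (cong (λ b′ → b * a + (- a) * b′) eq) (lemma a b))
        (suc i) → trans (combine b (- a) w w′ (N i))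
                    (trans (cong₂ (λ p q → b * p + (- a) * q) (Nw≡0 i) (Nw′≡0 i))
                      (lemma′ a b))
    where
    a = ∑[ l ] (M zero l * w l)
    lemma : ∀ a b → b * a + (- a) * b ≡ 0ℤ
    lemma = solve-∀
    lemma′ : ∀ a b → b * 0ℤ + (- a) * 0ℤ ≡ 0ℤ
    lemma′ = solve-∀
    nonzero : b * w j + (- a) * w′ j ≢ 0ℤ
    nonzero nz with i*j≡0⇒i≡0∨j≡0 b (trans (lemma″ a b (w j))
        (trans (cong (λ z → b * w j + (- a) * z) (sym w′ⱼ≡0)) nz))
      where
      lemma″ : ∀ a b w → b * w ≡ b * w + (- a) * 0ℤ
      lemma″ = solve-∀
    ... | inj₁ b≡0  = b≢0 b≡0
    ... | inj₂ wⱼ≡0 = wⱼ≢0 wⱼ≡0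

-- The unit vector `δ i` is in the left kernel, so det M = 0.
zeroRow⇒kernel : (M : Fin k → Fin k → ℤ) (i : Fin k) → (∀ j → M i j ≡ 0ℤ) → HasKernel M
zeroRow⇒kernel M i Mᵢ≡0 = det≡0⇒kernel M
  (det-leftKernel M (δ i) (i , subst (_≢ 0ℤ) (sym (δ-refl i)) λ ())
    λ j → trans (∑-δ i λ i′ → M i′ j) (Mᵢ≡0 j))

-- If M w = 0 and wⱼ ≠ 0, then in a system u M = 0 the equation of column j
-- follows from the others, so that it may be replaced by 0 = 0.

kernel⇒det≡0 : (M : Fin k → Fin k → ℤ) → HasKernel M → det M ≡ 0ℤ
kernel⇒det≡0 {k} M (w , (j , wⱼ≢0) , Mw≡0)
  with zeroRow⇒kernel M′ j row-j
  where
  -- Transposed, because the unknown u multiplies M from the left; the equation of column j becomes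
  -- row j, which is cleared.
  M′ : Fin k → Fin k → ℤ
  M′ j′ i with j ≟ j′
  ... | yes _ = 0ℤ
  ... | no _  = M i j′
  row-j : ∀ i → M′ j i ≡ 0ℤ
  row-j i with j ≟ j
  ... | yes _  = refl
  ... | no j≢j = contradiction refl j≢j
... | u , u≢0 , M′u≡0 = det-leftKernel M u u≢0 uM≡0
  where
  open ≡-Reasoning
  others : ∀ j′ → j′ ≢ j → ∑[ i ] (u i * M i j′) ≡ 0ℤ
  others j′ j′≢j with j ≟ j′ | M′u≡0 j′
  ... | yes j≡j′ | _  = contradiction (sym j≡j′) j′≢j
  ... | no _     | eq = trans (∑-cong λ i → *-comm (u i) (M i j′)) eq
  -- In (u M) w only the term of column j can be nonzero, while u (M w) = 0.
  wⱼ*uM≡0 : w j * (∑[ i ] (u i * M i j)) ≡ 0ℤ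
  wⱼ*uM≡0 = begin
    w j * (∑[ i ] (u i * M i j))
      ≡⟨ ∑-single j (λ j′ j′≢j → *-vanishʳ (w j′) (others j′ j′≢j)) ⟨
    ∑[ j ] (w j * ∑[ i ] (u i * M i j))
      ≡⟨ ∑-cong (λ j → ∑-distribˡ-* (w j) λ i → u i * M i j) ⟩
    ∑[ j ] ∑[ i ] (w j * (u i * M i j))
      ≡⟨ ∑-comm (λ j i → w j * (u i * M i j)) ⟩
    ∑[ i ] ∑[ j ] (w j * (u i * M i j))
      ≡⟨ ∑-cong (λ i → trans (∑-cong λ j → lemma (w j) (u i) (M i j))
           (sym (∑-distribˡ-* (u i) λ j → M i j * w j))) ⟩
    ∑[ i ] (u i * ∑[ j ] (M i j * w j))
      ≡⟨ ∑-zero (λ i → *-vanishʳ (u i) (Mw≡0 i)) ⟩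
    0ℤ ∎
    where
    lemma : ∀ w u a → w * (u * a) ≡ u * (a * w)
    lemma = solve-∀
  uM≡0 : ∀ j′ → ∑[ i ] (u i * M i j′) ≡ 0ℤ
  uM≡0 j′ with j′ ≟ j
  ... | no j′≢j  = others j′ j′≢j
  ... | yes refl with i*j≡0⇒i≡0∨j≡0 (w j) wⱼ*uM≡0
  ...   | inj₁ wⱼ≡0 = contradiction wⱼ≡0 wⱼ≢0
  ...   | inj₂ eq   = eq

-- Dodgson polynomials and networks

Kept : Subset m → Fin m ⊎ Fin n → Set
Kept X (inj₁ e) = e ∉ X
Kept X (inj₂ v) = ⊤

-- Hides the order in which the rows or columns of the minor are listed. By `extend` and `∑-kept`, a
-- vector on the kept indices may be treated as one on all edges and vertices that is zero on X.
record Enumerates (X : Subset m) (ix : Fin k → Fin m ⊎ Fin n) : Set where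
  field
    sound    : ∀ i → Kept X (ix i)
    complete : ∀ c → Kept X c → ∃ λ i → ix i ≡ c
    extend   : (w : Fin k → ℤ) → ∃ λ (W : Fin m ⊎ Fin n → ℤ) →
               (∀ i → W (ix i) ≡ w i) × (∀ e → e ∈ X → W (inj₁ e) ≡ 0ℤ)
    ∑-kept   : (W : Fin m ⊎ Fin n → ℤ) → (∀ e → e ∈ X → W (inj₁ e) ≡ 0ℤ) →
               ∑[ i ] W (ix i) ≡ ∑[ e ] W (inj₁ e) + ∑[ v ] W (inj₂ v)

enumerates-cast : {X : Subset m} {ix : Fin l → Fin m ⊎ Fin n} (eq : k ≡ l) →
                  Enumerates X ix → Enumerates X (ix ∘ cast eq)
enumerates-cast {X = X} {ix} refl E = record
  { sound    = λ i → sound (cast refl i)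
  ; complete = λ c kept → case complete c kept of λ where
      (i , eq) → i , trans (cong ix (cast-is-id refl i)) eq
  ; extend   = λ w → case extend w of λ where
      (W , eq , W≡0) → W , (λ i → trans (cong (W ∘ ix) (cast-is-id refl i)) (eq i)) , W≡0
  ; ∑-kept   = λ W W≡0 →
      trans (∑-cong λ i → cong (W ∘ ix) (cast-is-id refl i)) (∑-kept W W≡0)
  }
  where open Enumerates E

element : (X : Subset m) → Fin ∣ X ∣ → Fin m
element X = lookup (elements X)

element-∈ : (X : Subset m) (i : Fin ∣ X ∣) → element X i ∈ X
element-∈ (inside  ∷ X) zero    = here
element-∈ (inside  ∷ X) (suc i) =
  subst (_∈ inside ∷ X) (sym (Vec.lookup-map i suc (elements X))) (there (element-∈ X i))
element-∈ (outside ∷ X) i =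
  subst (_∈ outside ∷ X) (sym (Vec.lookup-map i suc (elements X))) (there (element-∈ X i))

element-surjective : (X : Subset m) {e : Fin m} → e ∈ X → ∃ λ i → element X i ≡ e
element-surjective (inside  ∷ X) here        = zero , refl
element-surjective (inside  ∷ X) (there e∈X) with element-surjective X e∈X
... | i , eq = suc i , trans (Vec.lookup-map i suc (elements X)) (cong suc eq)
element-surjective (outside ∷ X) (there e∈X) with element-surjective X e∈X
... | i , eq = i , trans (Vec.lookup-map i suc (elements X)) (cong suc eq)

∑-element : (X : Subset m) (t : Fin m → ℤ) → (∀ e → e ∉ X → t e ≡ 0ℤ) →
            ∑[ i ] t (element X i) ≡ ∑ t
∑-element []            t t≡0 = ∑-cong λ ()
∑-element (inside  ∷ X) t t≡0 = trans (∑-suc λ i → t (element (inside ∷ X) i))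
  (trans (cong (_+_ (t zero)) (trans
    (∑-cong λ i → cong t (Vec.lookup-map i suc (elements X)))
    (∑-element X (t ∘ suc) λ e e∉X → t≡0 (suc e) (e∉X ∘ drop-there))))
  (sym (∑-suc t)))
∑-element (outside ∷ X) t t≡0 = trans
  (∑-cong λ i → cong t (Vec.lookup-map i suc (elements X)))
  (trans (∑-element X (t ∘ suc) λ e e∉X → t≡0 (suc e) (e∉X ∘ drop-there))
  (trans (sym (+-identityˡ _))
  (trans (cong (_+ (∑[ e ] t (suc e))) (sym (t≡0 zero λ ())))
  (sym (∑-suc t)))))

element-extend : (X : Subset m) (w : Fin ∣ X ∣ → ℤ) → ∃ λ (a : Fin m → ℤ) →
                 (∀ i → a (element X i) ≡ w i) × (∀ e → e ∉ X → a e ≡ 0ℤ)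
element-extend []            w = (λ ()) , (λ ()) , λ ()
element-extend {suc m} (inside  ∷ X) w with element-extend X (w ∘ suc)
... | a , eq , a≡0 = a′ , eq′ , a′≡0
  where
  a′ : Fin (suc m) → ℤ
  a′ zero    = w zero
  a′ (suc e) = a e
  eq′ : ∀ i → a′ (element (inside ∷ X) i) ≡ w i
  eq′ zero    = refl
  eq′ (suc i) = trans (cong a′ (Vec.lookup-map i suc (elements X))) (eq i)
  a′≡0 : ∀ e → e ∉ inside ∷ X → a′ e ≡ 0ℤ
  a′≡0 zero    e∉X = contradiction here e∉X
  a′≡0 (suc e) e∉X = a≡0 e (e∉X ∘ there)
element-extend {suc m} (outside ∷ X) w with element-extend X w
... | a , eq , a≡0 = a′ , (λ i → trans (cong a′ (Vec.lookup-map i suc (elements X))) (eq i)) , a′≡0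
  where
  a′ : Fin (suc m) → ℤ
  a′ zero    = 0ℤ
  a′ (suc e) = a e
  a′≡0 : ∀ e → e ∉ outside ∷ X → a′ e ≡ 0ℤ
  a′≡0 zero    e∉X = refl
  a′≡0 (suc e) e∉X = a≡0 e (e∉X ∘ there)

remaining-enumerates : (X : Subset m) → Enumerates {n = n} X (lookup (remaining X))
remaining-enumerates {m} {n} X = record
  { sound    = sound
  ; complete = complete
  ; extend   = extend
  ; ∑-kept   = λ W W≡0 → begin
      ∑[ i ] W (ix i)
        ≡⟨ ∑-splitAt ∣ ∁ X ∣ (λ i → W (ix i)) ⟩
      ∑[ i ] W (ix (i ↑ˡ n)) + ∑[ v ] W (ix (∣ ∁ X ∣ ↑ʳ v))
        ≡⟨ cong₂ _+_ (∑-cong λ i → cong W (left i)) (∑-cong λ v → cong W (right v)) ⟩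
      ∑[ i ] W (inj₁ (element (∁ X) i)) + ∑[ v ] W (inj₂ v)
        ≡⟨ cong (_+ (∑[ v ] W (inj₂ v))) (∑-element (∁ X) (λ e → W (inj₁ e)) λ e e∉∁X →
             W≡0 e (x∉∁p⇒x∈p e∉∁X)) ⟩
      ∑[ e ] W (inj₁ e) + ∑[ v ] W (inj₂ v) ∎
  }
  where
  open ≡-Reasoning
  edges = Vec.map inj₁ (elements (∁ X))
  vertices = Vec.map {B = Fin m ⊎ Fin n} inj₂ (allFin n)
  ix : Fin (∣ ∁ X ∣ ℕ.+ n) → Fin m ⊎ Fin n
  ix = lookup (remaining X)
  left : ∀ i → ix (i ↑ˡ n) ≡ inj₁ (element (∁ X) i)
  left i = trans (Vec.lookup-++ˡ edges vertices i) (Vec.lookup-map i inj₁ (elements (∁ X)))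
  right : ∀ v → ix (∣ ∁ X ∣ ↑ʳ v) ≡ inj₂ v
  right v = trans (Vec.lookup-++ʳ edges vertices v)
    (trans (Vec.lookup-map v inj₂ (allFin n)) (cong inj₂ (Vec.lookup-allFin v)))
  sound : ∀ i → Kept X (ix i)
  sound i with splitAt ∣ ∁ X ∣ i in eq
  ... | inj₁ j rewrite sym (splitAt⁻¹-↑ˡ eq) | left j = x∈∁p⇒x∉p (element-∈ (∁ X) j)
  ... | inj₂ v rewrite sym (splitAt⁻¹-↑ʳ eq) | right v = tt
  complete : ∀ c → Kept X c → ∃ λ i → ix i ≡ c
  complete (inj₁ e) e∉X with element-surjective (∁ X) (x∉p⇒x∈∁p e∉X)
  ... | i , eq = i ↑ˡ n , trans (left i) (cong inj₁ eq)
  complete (inj₂ v) _ = ∣ ∁ X ∣ ↑ʳ v , right v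
  extend : (w : Fin (∣ ∁ X ∣ ℕ.+ n) → ℤ) → ∃ λ (W : Fin m ⊎ Fin n → ℤ) →
           (∀ i → W (ix i) ≡ w i) × (∀ e → e ∈ X → W (inj₁ e) ≡ 0ℤ)
  extend w with element-extend (∁ X) (λ i → w (i ↑ˡ n))
  ... | a , eq , a≡0 = W , W≡w , λ e e∈X → a≡0 e (x∈p⇒x∉∁p e∈X)
    where
    W : Fin m ⊎ Fin n → ℤ
    W = [ a , (λ v → w (∣ ∁ X ∣ ↑ʳ v)) ]
    W≡w : ∀ i → W (ix i) ≡ w i
    W≡w i with splitAt ∣ ∁ X ∣ i in eq′
    ... | inj₁ j rewrite sym (splitAt⁻¹-↑ˡ eq′) = trans (cong W (left j)) (eq j)
    ... | inj₂ v rewrite sym (splitAt⁻¹-↑ʳ eq′) = cong W (right v)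

-- The boundary operator: the net current flowing out of z, to which loops contribute nothing.
∂ : Graph n m → (Fin m → ℤ) → Fin (suc n) → ℤ
∂ G a z = ∑[ e ] (incidence G e z * a e)

∑-incidence : (G : Graph n m) (e : Fin m) (y : Fin (suc n) → ℤ) →
              ∑[ z ] (incidence G e z * y z) ≡ y (source G e) - y (target G e)
∑-incidence G e y = begin
  ∑[ z ] (incidence G e z * y z)
    ≡⟨ ∑-cong (λ z → lemma (δ s z) (δ t z) (y z)) ⟩
  ∑[ z ] (δ s z * y z + - (δ t z * y z))
    ≡⟨ ∑-distrib-+ (λ z → δ s z * y z) (λ z → - (δ t z * y z)) ⟩
  ∑[ z ] (δ s z * y z) + ∑[ z ] (- (δ t z * y z))
    ≡⟨ cong₂ _+_ (∑-δ s y) (trans (∑-neg (λ z → δ t z * y z)) (cong -_ (∑-δ t y))) ⟩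
  y s - y t ∎
  where
  open ≡-Reasoning
  s = source G e
  t = target G e
  lemma : ∀ a b c → (a - b) * c ≡ a * c + - (b * c)
  lemma = solve-∀

-- Summation by parts, from exchanging the two sums. For a conserved current the left side is zero,
-- which later makes the energy vanish.
∑-∂ : (G : Graph n m) (a : Fin m → ℤ) (y : Fin (suc n) → ℤ) →
      ∑[ z ] (y z * ∂ G a z) ≡ ∑[ e ] (a e * (y (source G e) - y (target G e)))
∑-∂ G a y = begin
  ∑[ z ] (y z * ∂ G a z)
    ≡⟨ ∑-cong (λ z → ∑-distribˡ-* (y z) λ e → incidence G e z * a e) ⟩
  ∑[ z ] ∑[ e ] (y z * (incidence G e z * a e))
    ≡⟨ ∑-comm (λ z e → y z * (incidence G e z * a e)) ⟩
  ∑[ e ] ∑[ z ] (y z * (incidence G e z * a e))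
    ≡⟨ ∑-cong (λ e → trans (∑-cong λ z → lemma (y z) (incidence G e z) (a e))
         (sym (∑-distribˡ-* (a e) λ z → incidence G e z * y z))) ⟩
  ∑[ e ] (a e * ∑[ z ] (incidence G e z * y z))
    ≡⟨ ∑-cong (λ e → cong (a e *_) (∑-incidence G e y)) ⟩
  ∑[ e ] (a e * (y (source G e) - y (target G e))) ∎
  where
  open ≡-Reasoning
  lemma : ∀ y i a → y * (i * a) ≡ a * (i * y)
  lemma = solve-∀

-- Summation by parts against the constant potential 1 shows that the net outflows add up to zero.
-- Hence the conservation law at any one chosen vertex follows from the others.
∂≡0-except : (G : Graph n m) (a : Fin m → ℤ) (v : Fin (suc n)) →
             (∀ z → z ≢ v → ∂ G a z ≡ 0ℤ) → ∀ z → ∂ G a z ≡ 0ℤ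
∂≡0-except G a v ∂≡0 z with z ≟ v
... | no z≢v   = ∂≡0 z z≢v
... | yes refl = begin
  ∂ G a v                     ≡⟨ *-identityˡ (∂ G a v) ⟨
  1ℤ * ∂ G a v                ≡⟨ ∑-single v (λ z z≢v → *-vanishʳ 1ℤ (∂≡0 z z≢v)) ⟨
  ∑[ z ] (1ℤ * ∂ G a z)       ≡⟨ ∑-∂ G a (λ _ → 1ℤ) ⟩
  ∑[ e ] (a e * (1ℤ - 1ℤ))    ≡⟨ ∑-zero (λ e → *-zeroʳ (a e)) ⟩
  0ℤ                          ∎
  where open ≡-Reasoning

weight : Subset m → (Fin m → ℤ) → Fin m → ℤ
weight K x e = if ⌊ e ∈? K ⌋ then 0ℤ else x e

-- A kernel vector of the matrix of Ψ^{I,J}_K at α = x, read as currents a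
-- and potentials y.  Deleting a column of the incidence matrix amounts to
-- taking potentials up to a constant.

record Solution (G : Graph n m) (I J K : Subset m) (x : Fin m → ℤ)
                (a : Fin m → ℤ) (y : Fin (suc n) → ℤ) : Set where
  field
    support  : ∀ e → e ∈ J → a e ≡ 0ℤ
    ohm      : ∀ e → e ∉ I →
               weight K x e * a e + (y (source G e) - y (target G e)) ≡ 0ℤ
    conserve : ∀ z → ∂ G a z ≡ 0ℤ

-- Potentials count only up to a constant, so zero currents with constant potentials represent the
-- zero vector.
Nontrivial : (Fin m → ℤ) → (Fin (suc n) → ℤ) → Set
Nontrivial a y = (∃ λ e → a e ≢ 0ℤ) ⊎ (∃₂ λ u w → y u ≢ y w)

Degenerate : Graph n m → (I J K : Subset m) → (Fin m → ℤ) → Set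
Degenerate G I J K x = ∃₂ λ a y → Solution G I J K x a y × Nontrivial a y

module _ (G : Graph n m) (I J K : Subset m) (x : Fin m → ℤ) where

  private
    entry : Fin m ⊎ Fin n → Fin m ⊎ Fin n → ℤ
    entry r c = eval x (graphMatrix G K r c)

    entry-diagonal : ∀ e → entry (inj₁ e) (inj₁ e) ≡ weight K x e
    entry-diagonal e with e ≟ e | e ∈? K
    ... | yes _  | no _  = eval-α x e
    ... | yes _  | yes _ = eval-constant x 0ℤ
    ... | no e≢e | _     = contradiction refl e≢e

    entry-offDiagonal : ∀ e f → e ≢ f → entry (inj₁ e) (inj₁ f) ≡ 0ℤ
    entry-offDiagonal e f e≢f with e ≟ f | e ∈? K
    ... | yes e≡f | _ = contradiction e≡f e≢f
    ... | no _    | _ = eval-constant x 0ℤ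

    -- Grounds vertex zero, the vertex whose incidence column is deleted.
    potential : (Fin n → ℤ) → Fin (suc n) → ℤ
    potential y zero    = 0ℤ
    potential y (suc v) = y v

    rowValue : (Fin m → ℤ) → (Fin n → ℤ) → Fin m ⊎ Fin n → ℤ
    rowValue a y (inj₁ e) = weight K x e * a e
      + (potential y (source G e) - potential y (target G e))
    rowValue a y (inj₂ v) = - ∂ G a (suc v)

    row-value : (W : Fin m ⊎ Fin n → ℤ) (r : Fin m ⊎ Fin n) →
                ∑[ e ] (entry r (inj₁ e) * W (inj₁ e))
                + ∑[ v ] (entry r (inj₂ v) * W (inj₂ v))
                ≡ rowValue (λ e → W (inj₁ e)) (λ v → W (inj₂ v)) r
    row-value W (inj₁ e) = cong₂ _+_
      (trans (∑-single e λ f f≢e → cong (_* W (inj₁ f)) (entry-offDiagonal e f (f≢e ∘ sym)))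
        (cong (_* W (inj₁ e)) (entry-diagonal e)))
      (begin
        ∑[ v ] (entry (inj₁ e) (inj₂ v) * W (inj₂ v))
          ≡⟨ ∑-cong (λ v → cong (_* W (inj₂ v)) (eval-constant x (incidence G e (suc v)))) ⟩
        ∑[ v ] (incidence G e (suc v) * W (inj₂ v))
          ≡⟨ +-identityˡ _ ⟨
        0ℤ + ∑[ v ] (incidence G e (suc v) * W (inj₂ v))
          ≡⟨ cong (_+ (∑[ v ] (incidence G e (suc v) * W (inj₂ v))))
               (*-zeroʳ (incidence G e zero)) ⟨
        incidence G e zero * 0ℤ + ∑[ v ] (incidence G e (suc v) * W (inj₂ v))
          ≡⟨ ∑-suc (λ z → incidence G e z * y z) ⟨
        ∑[ z ] (incidence G e z * y z)
          ≡⟨ ∑-incidence G e y ⟩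
        y (source G e) - y (target G e) ∎)
      where
      open ≡-Reasoning
      y = potential (λ v → W (inj₂ v))
    row-value W (inj₂ v) = trans (cong₂ _+_
      (trans (∑-cong λ e → trans
          (cong (_* W (inj₁ e)) (eval-constant x (- incidence G e (suc v))))
          (sym (neg-distribˡ-* (incidence G e (suc v)) (W (inj₁ e)))))
        (∑-neg λ e → incidence G e (suc v) * W (inj₁ e)))
      (∑-zero λ w → cong (_* W (inj₂ w)) (eval-constant x 0ℤ)))
      (+-identityʳ _)

    module _ {r c : Fin k → Fin m ⊎ Fin n}
             (R : Enumerates I r) (C : Enumerates J c) where

      private
        module R = Enumerates R
        module C = Enumerates C

      matrix : Fin k → Fin k → ℤ
      matrix i j = entry (r i) (c j)

      matrix-row : (W : Fin m ⊎ Fin n → ℤ) → (∀ e → e ∈ J → W (inj₁ e) ≡ 0ℤ) → ∀ i →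
                   ∑[ j ] (matrix i j * W (c j))
                   ≡ rowValue (λ e → W (inj₁ e)) (λ v → W (inj₂ v)) (r i)
      matrix-row W W≡0 i = trans
        (C.∑-kept (λ z → entry (r i) z * W z) λ e e∈J →
          *-vanishʳ (entry (r i) (inj₁ e)) (W≡0 e e∈J))
        (row-value W (r i))

      kernel⇒degenerate : HasKernel matrix → Degenerate G I J K x
      kernel⇒degenerate (w , (j , wⱼ≢0) , Mw≡0) with C.extend w
      ... | W , W≡w , W≡0 = a , y , record
          { support  = W≡0
          ; ohm      = λ e e∉I → row (inj₁ e) e∉I
          ; conserve = ∂≡0-except G a zero λ where
              zero    0≢0 → contradiction refl 0≢0
              (suc v) _   → neg-injective (row (inj₂ v) tt)
          } , nontrivial (c j) refl
        where
        a : Fin m → ℤ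
        a e = W (inj₁ e)
        y : Fin (suc n) → ℤ
        y = potential λ v → W (inj₂ v)
        row : ∀ z → Kept I z → rowValue a (λ v → W (inj₂ v)) z ≡ 0ℤ
        row z kept with R.complete z kept
        ... | i , refl = trans (sym (matrix-row W W≡0 i))
          (trans (∑-cong λ j → cong (matrix i j *_) (W≡w j)) (Mw≡0 i))
        nontrivial : ∀ z → c j ≡ z → Nontrivial a y
        nontrivial (inj₁ e) eq = inj₁ (e , λ a≡0 →
          wⱼ≢0 (trans (sym (W≡w j)) (trans (cong W eq) a≡0)))
        nontrivial (inj₂ v) eq = inj₂ (suc v , zero , λ y≡0 →
          wⱼ≢0 (trans (sym (W≡w j)) (trans (cong W eq) y≡0)))

      degenerate⇒kernel : Degenerate G I J K x → HasKernel matrix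
      degenerate⇒kernel (a , y , sol , nontrivial) =
        (λ j → W (c j)) , nonzero nontrivial , λ i →
          trans (matrix-row W support i) (row (r i) (R.sound i))
        where
        open Solution sol
        -- Subtracting the potential of vertex zero grounds that vertex and preserves all potential
        -- drops.
        W : Fin m ⊎ Fin n → ℤ
        W = [ a , (λ v → y (suc v) - y zero) ]
        y-shift : ∀ z → potential (λ v → W (inj₂ v)) z ≡ y z - y zero
        y-shift zero    = sym (+-inverseʳ (y zero))
        y-shift (suc v) = refl
        row : ∀ z → Kept I z → rowValue a (λ v → W (inj₂ v)) z ≡ 0ℤ
        row (inj₁ e) e∉I = trans (cong (_+_ (weight K x e * a e))
          (trans (cong₂ _-_ (y-shift (source G e)) (y-shift (target G e)))
            (lemma (y (source G e)) (y (target G e)) (y zero))))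
          (ohm e e∉I)
          where
          lemma : ∀ s t o → (s - o) - (t - o) ≡ s - t
          lemma = solve-∀
        row (inj₂ v) _ = cong -_ (conserve (suc v))
        nonzeroAt : ∀ z → Kept J z → W z ≢ 0ℤ → ∃ λ j → W (c j) ≢ 0ℤ
        nonzeroAt z kept W≢0 with C.complete z kept
        ... | j , refl = j , W≢0
        nonconstant : ∀ u → y u ≢ y zero → ∃ λ j → W (c j) ≢ 0ℤ
        nonconstant zero    y≢y = contradiction refl y≢y
        nonconstant (suc v) y≢y = nonzeroAt (inj₂ v) tt (y≢y ∘ i-j≡0⇒i≡j (y (suc v)) (y zero))
        nonzero : Nontrivial a y → ∃ λ j → W (c j) ≢ 0ℤ
        nonzero (inj₁ (e , aₑ≢0)) =
          nonzeroAt (inj₁ e) (λ e∈J → aₑ≢0 (support e e∈J)) aₑ≢0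
        nonzero (inj₂ (u , w , yᵤ≢y_w)) with y u ℤ.≟ y zero
        ... | no yᵤ≢y₀  = nonconstant u yᵤ≢y₀
        ... | yes yᵤ≡y₀ = nonconstant w λ y_w≡y₀ → yᵤ≢y_w (trans yᵤ≡y₀ (sym y_w≡y₀))

  module _ (eq : ∣ I ∣ ≡ ∣ J ∣) where

    private
      rows = remaining-enumerates {n = n} I
      columns = enumerates-cast (remaining-square {n = n} I J eq) (remaining-enumerates J)

      eval-dodgson : eval x (dodgson G I J K eq) ≡ det (matrix rows columns)
      eval-dodgson = eval-det x λ i j → graphMatrix G K (lookup (remaining I) i)
        (lookup (remaining J) (cast (remaining-square {n = n} I J eq) j))

    dodgson≡0⇒degenerate : eval x (dodgson G I J K eq) ≡ 0ℤ → Degenerate G I J K x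
    dodgson≡0⇒degenerate Ψ≡0 = kernel⇒degenerate rows columns
      (det≡0⇒kernel (matrix rows columns) (trans (sym eval-dodgson) Ψ≡0))

    degenerate⇒dodgson≡0 : Degenerate G I J K x → eval x (dodgson G I J K eq) ≡ 0ℤ
    degenerate⇒dodgson≡0 D = trans eval-dodgson
      (kernel⇒det≡0 (matrix rows columns) (degenerate⇒kernel rows columns D))

-- Degeneracy makes Ψ zero at each integer point, hence identically zero.
splits-degenerate : (G : Graph n m) {S I J K : Subset m} → DodgsonTriple S I J K →
                    (∀ x → Degenerate G I J K x) → ConfigurationSplits G S
splits-degenerate {m = m} G {I = I} {J} {K} T D = I , J , K , T ,
  isZero-eval (dodgson G I J K balanced) λ x →
    degenerate⇒dodgson≡0 G I J K x balanced (D x)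
  where open DodgsonTriple T

-- Homogeneous linear systems

-- Linearity is witnessed by explicit coefficients, from which the matrix of a system is read off.
Linear : ((Fin k → ℤ) → (Fin l → ℤ) → ℤ) → Set
Linear {k} {l} f = ∃₂ λ (c : Fin k → ℤ) (d : Fin l → ℤ) →
  ∀ a y → f a y ≡ ∑[ e ] (c e * a e) + ∑[ z ] (d z * y z)

linear-0 : Linear {k} {l} λ a y → 0ℤ
linear-0 = (λ _ → 0ℤ) , (λ _ → 0ℤ) , λ a y →
  sym (cong₂ _+_ (∑-zero λ _ → refl) (∑-zero λ _ → refl))

linear-∑ : (c : Fin k → ℤ) → Linear {k} {l} λ a y → ∑[ e ] (c e * a e)
linear-∑ c = c , (λ _ → 0ℤ) , λ a y →
  sym (trans (cong (_+_ (∑[ e ] (c e * a e))) (∑-zero λ _ → refl)) (+-identityʳ _))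

linear-current : (e : Fin k) → Linear {k} {l} λ a y → a e
linear-current e = case linear-∑ (δ e) of λ where
  (c , d , eq) → c , d , λ a y → trans (sym (∑-δ e a)) (eq a y)

linear-potential : (z : Fin l) → Linear {k} {l} λ a y → y z
linear-potential z = (λ _ → 0ℤ) , δ z , λ a y → sym (trans
  (cong₂ _+_ (∑-zero λ _ → refl) (∑-δ z y)) (+-identityˡ (y z)))

linear-+ : {f g : (Fin k → ℤ) → (Fin l → ℤ) → ℤ} →
           Linear f → Linear g → Linear λ a y → f a y + g a y
linear-+ (c , d , eq) (c′ , d′ , eq′) = (λ e → c e + c′ e) , (λ z → d z + d′ z) , λ a y →
  trans (cong₂ _+_ (eq a y) (eq′ a y))
    (trans (interchange (∑[ e ] (c e * a e)) (∑[ z ] (d z * y z))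
             (∑[ e ] (c′ e * a e)) (∑[ z ] (d′ z * y z)))
      (cong₂ _+_ (collect c c′ a) (collect d d′ y)))
  where
  interchange : ∀ p q r s → (p + q) + (r + s) ≡ (p + r) + (q + s)
  interchange = solve-∀
  collect : ∀ {k} (c c′ a : Fin k → ℤ) →
            ∑[ e ] (c e * a e) + ∑[ e ] (c′ e * a e) ≡ ∑[ e ] ((c e + c′ e) * a e)
  collect c c′ a = trans (sym (∑-distrib-+ (λ e → c e * a e) (λ e → c′ e * a e)))
    (∑-cong λ e → sym (*-distribʳ-+ (a e) (c e) (c′ e)))

linear-* : {f : (Fin k → ℤ) → (Fin l → ℤ) → ℤ} (r : ℤ) →
           Linear f → Linear λ a y → r * f a y
linear-* r (c , d , eq) = (λ e → r * c e) , (λ z → r * d z) , λ a y →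
  trans (cong (r *_) (eq a y))
    (trans (*-distribˡ-+ r (∑[ e ] (c e * a e)) (∑[ z ] (d z * y z)))
      (cong₂ _+_ (collect c a) (collect d y)))
  where
  collect : ∀ {k} (c a : Fin k → ℤ) → r * ∑[ e ] (c e * a e) ≡ ∑[ e ] (r * c e * a e)
  collect c a = trans (∑-distribˡ-* r λ e → c e * a e)
    (∑-cong λ e → sym (*-assoc r (c e) (a e)))

linear-sub : {f g : (Fin k → ℤ) → (Fin l → ℤ) → ℤ} →
           Linear f → Linear g → Linear λ a y → f a y - g a y
linear-sub {f = f} {g} F G = case linear-+ F (linear-* ℤ.-1ℤ G) of λ where
  (c , d , eq) → c , d , λ a y → trans (cong (_+_ (f a y)) (sym (-1*i≡-i (g a y)))) (eq a y)

-- Since one of the equations is void, there are more unknowns than equations.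

nontrivialSolution :
  (f : Fin k ⊎ Fin l → (Fin k → ℤ) → (Fin l → ℤ) → ℤ) → (∀ r → Linear (f r)) →
  (p : Fin k ⊎ Fin l) → (∀ a y → f p a y ≡ 0ℤ) →
  ∃₂ λ a y → ((∃ λ e → a e ≢ 0ℤ) ⊎ (∃ λ z → y z ≢ 0ℤ)) × (∀ r → f r a y ≡ 0ℤ)
nontrivialSolution {k} {l} f L p fₚ≡0 = solve (zeroRow⇒kernel M (index p) void)
  where
  coefficient : Fin k ⊎ Fin l → Fin (k ℕ.+ l) → ℤ
  coefficient r j with L r
  ... | c , d , _ = [ c , d ] (splitAt k j)
  index : Fin k ⊎ Fin l → Fin (k ℕ.+ l)
  index = [ _↑ˡ l , k ↑ʳ_ ]
  splitAt-index : ∀ r → splitAt k (index r) ≡ r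
  splitAt-index (inj₁ e) = splitAt-↑ˡ k e l
  splitAt-index (inj₂ z) = splitAt-↑ʳ k l z
  M : Fin (k ℕ.+ l) → Fin (k ℕ.+ l) → ℤ
  M i = coefficient (splitAt k i)
  value : ∀ r w → ∑[ j ] (coefficient r j * w j) ≡ f r (λ e → w (e ↑ˡ l)) (λ z → w (k ↑ʳ z))
  value r w with L r
  ... | c , d , eq = trans (∑-splitAt k λ j → [ c , d ] (splitAt k j) * w j)
    (trans (cong₂ _+_
      (∑-cong λ e → cong (λ s → [ c , d ] s * w (e ↑ˡ l)) (splitAt-↑ˡ k e l))
      (∑-cong λ z → cong (λ s → [ c , d ] s * w (k ↑ʳ z)) (splitAt-↑ʳ k l z)))
      (sym (eq (λ e → w (e ↑ˡ l)) (λ z → w (k ↑ʳ z)))))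
  void : ∀ j → M (index p) j ≡ 0ℤ
  -- The j-th coefficient of the functional is its value at the unit vector `δ j`, which is zero for
  -- the void equation p.
  void j rewrite splitAt-index p = begin
    coefficient p j                          ≡⟨ ∑-δ j (coefficient p) ⟨
    ∑[ i ] (δ j i * coefficient p i)         ≡⟨ ∑-cong (λ i → *-comm (δ j i) _) ⟩
    ∑[ i ] (coefficient p i * δ j i)         ≡⟨ value p (δ j) ⟩
    f p _ _                                  ≡⟨ fₚ≡0 _ _ ⟩
    0ℤ                                       ∎
    where open ≡-Reasoning
  solve : HasKernel M → _
  solve (w , (j , wⱼ≢0) , Mw≡0) = a , y , nonzero , λ r →
      trans (sym (value r w)) (trans
        (∑-cong λ i → cong (λ s → coefficient s i * w i) (sym (splitAt-index r)))
        (Mw≡0 (index r)))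
    where
    a : Fin k → ℤ
    a e = w (e ↑ˡ l)
    y : Fin l → ℤ
    y z = w (k ↑ʳ z)
    nonzero : (∃ λ e → a e ≢ 0ℤ) ⊎ (∃ λ z → y z ≢ 0ℤ)
    nonzero with splitAt k j in eq
    ... | inj₁ e = inj₁ (e , λ a≡0 → wⱼ≢0 (trans (cong w (sym (splitAt⁻¹-↑ˡ eq))) a≡0))
    ... | inj₂ z = inj₂ (z , λ y≡0 → wⱼ≢0 (trans (cong w (sym (splitAt⁻¹-↑ʳ {m = k} eq))) y≡0))

-- With one vertex besides v, conservation is a single equation for the two
-- currents through p and q.

twoVertices-degenerate :
  (G : Graph n m) (I J K : Subset m) (v z₀ : Fin (suc n)) → (∀ z → z ≢ v → z ≡ z₀) →
  {p q : Fin m} → p ≢ q → p ∈ I → q ∈ I → p ∉ J → q ∉ J → ∀ x → Degenerate G I J K x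
twoVertices-degenerate {n} {m} G I J K v z₀ only {p} {q} p≢q p∈I q∈I p∉J q∉J x =
  solve (nontrivialSolution f f-linear (inj₁ p) fₚ≡0)
  where
  -- Row p is void and row q holds the one conservation law; the remaining rows set all other
  -- currents and all potentials to zero.
  edgeRow : ∀ e → Dec (e ≡ p) → Dec (e ≡ q) → (Fin m → ℤ) → ℤ
  edgeRow e (yes _) _       a = 0ℤ
  edgeRow e (no _)  (yes _) a = ∂ G a z₀
  edgeRow e (no _)  (no _)  a = a e
  f : Fin m ⊎ Fin (suc n) → (Fin m → ℤ) → (Fin (suc n) → ℤ) → ℤ
  f (inj₁ e) a y = edgeRow e (e ≟ p) (e ≟ q) a
  f (inj₂ z) a y = y z
  f-linear : ∀ r → Linear (f r)
  f-linear (inj₁ e) with e ≟ p | e ≟ q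
  ... | yes _ | _     = linear-0
  ... | no _  | yes _ = linear-∑ λ e → incidence G e z₀
  ... | no _  | no _  = linear-current e
  f-linear (inj₂ z) = linear-potential z
  fₚ≡0 : ∀ a y → f (inj₁ p) a y ≡ 0ℤ
  fₚ≡0 a y with p ≟ p
  ... | yes _  = refl
  ... | no p≢p = contradiction refl p≢p
  solve : (∃₂ λ a y → ((∃ λ e → a e ≢ 0ℤ) ⊎ (∃ λ z → y z ≢ 0ℤ)) × (∀ r → f r a y ≡ 0ℤ)) →
          Degenerate G I J K x
  solve (a , y , nonzero , fay≡0) = a , y , record
      { support  = λ e e∈J → other e (λ { refl → p∉J e∈J }) (λ { refl → q∉J e∈J })
      ; ohm      = λ e e∉I → cong₂ _+_
          (*-vanishʳ (weight K x e)
            (other e (λ { refl → e∉I p∈I }) (λ { refl → e∉I q∈I })))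
          (cong₂ _-_ (fay≡0 (inj₂ (source G e))) (fay≡0 (inj₂ (target G e))))
      ; conserve = ∂≡0-except G a v λ z z≢v →
          subst (λ z → ∂ G a z ≡ 0ℤ) (sym (only z z≢v)) ∂z₀≡0
      } , nontrivial nonzero
    where
    other : ∀ e → e ≢ p → e ≢ q → a e ≡ 0ℤ
    other e e≢p e≢q with e ≟ p | e ≟ q | fay≡0 (inj₁ e)
    ... | yes e≡p | _       | _  = contradiction e≡p e≢p
    ... | no _    | yes e≡q | _  = contradiction e≡q e≢q
    ... | no _    | no _    | eq = eq
    ∂z₀≡0 : ∂ G a z₀ ≡ 0ℤ
    ∂z₀≡0 with q ≟ p | q ≟ q | fay≡0 (inj₁ q)
    ... | yes q≡p | _      | _  = contradiction (sym q≡p) p≢q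
    ... | no _    | no q≢q | _  = contradiction refl q≢q
    ... | no _    | yes _  | eq = eq
    nontrivial : (∃ λ e → a e ≢ 0ℤ) ⊎ (∃ λ z → y z ≢ 0ℤ) → Nontrivial a y
    nontrivial (inj₁ a≢0)       = inj₁ a≢0
    nontrivial (inj₂ (z , y≢0)) = contradiction (fay≡0 (inj₂ z)) y≢0

-- The components of G − v, coloured with two colours, and accordingly the
-- edges; loops at v may have either colour.

record Separation (G : Graph n m) (v : Fin (suc n)) : Set where
  field
    vertexSide  : Fin (suc n) → Bool
    edgeSide    : Fin m → Bool
    source-side : ∀ e → source G e ≢ v → vertexSide (source G e) ≡ edgeSide e
    target-side : ∀ e → target G e ≢ v → vertexSide (target G e) ≡ edgeSide e
    occupied    : ∀ b → ∃ λ z → z ≢ v × vertexSide z ≡ b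

module _ {G : Graph n m} {v : Fin (suc n)} (sep : Separation G v) where
  open Separation sep

  incidence-otherSide : ∀ {e z} → z ≢ v → vertexSide z ≢ edgeSide e → incidence G e z ≡ 0ℤ
  incidence-otherSide {e} {z} z≢v other = cong₂ _-_
    (δ-≢ {i = source G e} {z} λ { refl → other (source-side e z≢v) })
    (δ-≢ {i = target G e} {z} λ { refl → other (target-side e z≢v) })

  -- At a vertex other than v and off side b, edges of side b have incidence zero and all other
  -- edges carry no current. Conservation at v then follows from that elsewhere.
  conserve-oneSide : (b : Bool) (a : Fin m → ℤ) → (∀ e → edgeSide e ≢ b → a e ≡ 0ℤ) →
                     (∀ z → z ≢ v → vertexSide z ≡ b → ∂ G a z ≡ 0ℤ) →
                     ∀ z → ∂ G a z ≡ 0ℤ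
  conserve-oneSide b a a≡0 ∂≡0 = ∂≡0-except G a v λ z z≢v → away z z≢v
    where
    away : ∀ z → z ≢ v → ∂ G a z ≡ 0ℤ
    away z z≢v with vertexSide z Bool.≟ b
    ... | yes z∈b = ∂≡0 z z≢v z∈b
    ... | no z∉b  = ∑-zero term
      where
      term : ∀ e → incidence G e z * a e ≡ 0ℤ
      term e with edgeSide e Bool.≟ b
      ... | no e∉b  = *-vanishʳ (incidence G e z) (a≡0 e e∉b)
      ... | yes e∈b = cong (_* a e) (incidence-otherSide z≢v λ eq → z∉b (trans eq e∈b))

  restrict : Bool → (Fin m → ℤ) → Fin m → ℤ
  restrict b a e = if ⌊ edgeSide e Bool.≟ b ⌋ then a e else 0ℤ

  restrict-on : ∀ {b e} (a : Fin m → ℤ) → edgeSide e ≡ b → restrict b a e ≡ a e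
  restrict-on {b} {e} a e∈b with edgeSide e Bool.≟ b
  ... | yes _  = refl
  ... | no e∉b = contradiction e∈b e∉b

  restrict-off : ∀ {b e} (a : Fin m → ℤ) → edgeSide e ≢ b → restrict b a e ≡ 0ℤ
  restrict-off {b} {e} a e∉b with edgeSide e Bool.≟ b
  ... | yes e∈b = contradiction e∈b e∉b
  ... | no _    = refl

  -- A vertex of side b other than v meets only edges of that side, so dropping the other currents
  -- changes nothing there. Thus the two sides can be treated separately.
  restrict-conserve : (b : Bool) (a : Fin m → ℤ) → (∀ z → ∂ G a z ≡ 0ℤ) →
                      ∀ z → ∂ G (restrict b a) z ≡ 0ℤ
  restrict-conserve b a ∂≡0 = conserve-oneSide b (restrict b a) (λ e → restrict-off a)
    λ z z≢v z∈b → trans (∑-cong λ e → term z z≢v z∈b e) (∂≡0 z)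
    where
    term : ∀ z → z ≢ v → vertexSide z ≡ b → ∀ e →
           incidence G e z * restrict b a e ≡ incidence G e z * a e
    term z z≢v z∈b e with edgeSide e Bool.≟ b
    ... | yes _  = refl
    ... | no e∉b = trans (*-zeroʳ (incidence G e z))
      (sym (cong (_* a e) (incidence-otherSide z≢v λ eq → e∉b (trans (sym eq) z∈b))))

  -- On the side of p, the deletion of I leaves fewer equations than unknowns.

  unbalanced-degenerate : (I J K : Subset m) {p : Fin m} → p ∈ I →
                          (∀ e → e ∈ J → edgeSide e ≢ edgeSide p) →
                          ∀ x → Degenerate G I J K x
  unbalanced-degenerate I J K {p} p∈I J∌b x =
    solve (nontrivialSolution f f-linear (inj₁ p) fₚ≡0)
    where
    b = edgeSide p
    -- The void row is that of p, where p ∈ I exempts from Ohm's law. The other edges of side b obey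
    -- that law, and the currents off side b are set to zero.
    edgeRow : ∀ e → Dec (e ≡ p) → Dec (edgeSide e ≡ b) → (Fin m → ℤ) → (Fin (suc n) → ℤ) → ℤ
    edgeRow e (yes _) _       a y = 0ℤ
    edgeRow e (no _)  (yes _) a y =
      weight K x e * a e + (y (source G e) - y (target G e))
    edgeRow e (no _)  (no _)  a y = a e
    vertexRow : ∀ z → Dec (z ≡ v) → Dec (vertexSide z ≡ b) →
                (Fin m → ℤ) → (Fin (suc n) → ℤ) → ℤ
    vertexRow z (no _)  (yes _) a y = ∂ G a z
    vertexRow z (no _)  (no _)  a y = y z
    -- Conservation at v follows from that elsewhere, so its row is free to ground v. With all
    -- potentials off side b zero as well, Ohm's law holds there.
    vertexRow z (yes _) _       a y = y z
    f : Fin m ⊎ Fin (suc n) → (Fin m → ℤ) → (Fin (suc n) → ℤ) → ℤ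
    f (inj₁ e) = edgeRow e (e ≟ p) (edgeSide e Bool.≟ b)
    f (inj₂ z) = vertexRow z (z ≟ v) (vertexSide z Bool.≟ b)
    f-linear : ∀ r → Linear (f r)
    f-linear (inj₁ e) with e ≟ p | edgeSide e Bool.≟ b
    ... | yes _ | _     = linear-0
    ... | no _  | yes _ = linear-+ (linear-* (weight K x e) (linear-current e))
      (linear-sub (linear-potential (source G e)) (linear-potential (target G e)))
    ... | no _  | no _  = linear-current e
    f-linear (inj₂ z) with z ≟ v | vertexSide z Bool.≟ b
    ... | yes _ | _     = linear-potential z
    ... | no _  | yes _ = linear-∑ λ e → incidence G e z
    ... | no _  | no _  = linear-potential z
    fₚ≡0 : ∀ a y → f (inj₁ p) a y ≡ 0ℤ
    fₚ≡0 a y with p ≟ p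
    ... | yes _  = refl
    ... | no p≢p = contradiction refl p≢p
    solve : (∃₂ λ a y → ((∃ λ e → a e ≢ 0ℤ) ⊎ (∃ λ z → y z ≢ 0ℤ)) × (∀ r → f r a y ≡ 0ℤ)) →
            Degenerate G I J K x
    solve (a , y , nonzero , fay≡0) = a , y , record
        { support  = λ e e∈J → a-off e (J∌b e e∈J)
        ; ohm      = ohm
        ; conserve = conserve-oneSide b a a-off ∂≡0
        } , nontrivial nonzero
      where
      a-off : ∀ e → edgeSide e ≢ b → a e ≡ 0ℤ
      a-off e e∉b with e ≟ p | edgeSide e Bool.≟ b | fay≡0 (inj₁ e)
      ... | yes refl | _       | _  = contradiction refl e∉b
      ... | no _     | yes e∈b | _  = contradiction e∈b e∉b
      ... | no _     | no _    | eq = eq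
      yᵥ≡0 : y v ≡ 0ℤ
      yᵥ≡0 with v ≟ v | fay≡0 (inj₂ v)
      ... | yes _  | eq = eq
      ... | no v≢v | _  = contradiction refl v≢v
      y-off : ∀ z {e} → edgeSide e ≢ b → (z ≢ v → vertexSide z ≡ edgeSide e) → y z ≡ 0ℤ
      y-off z e∉b side with z ≟ v | vertexSide z Bool.≟ b | fay≡0 (inj₂ z)
      ... | yes refl | _       | _  = yᵥ≡0
      ... | no z≢v   | yes z∈b | _  = contradiction (trans (sym (side z≢v)) z∈b) e∉b
      ... | no _     | no _    | eq = eq
      ohm : ∀ e → e ∉ I → weight K x e * a e + (y (source G e) - y (target G e)) ≡ 0ℤ
      ohm e e∉I with edgeSide e Bool.≟ b
      ... | no e∉b  = cong₂ _+_ (*-vanishʳ (weight K x e) (a-off e e∉b))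
        (cong₂ _-_ (y-off (source G e) e∉b (source-side e)) (y-off (target G e) e∉b (target-side e)))
      ... | yes e∈b with e ≟ p | edgeSide e Bool.≟ b | fay≡0 (inj₁ e)
      ...   | yes refl | _      | _  = contradiction p∈I e∉I
      ...   | no _     | yes _  | eq = eq
      ...   | no _     | no e∉b | _  = contradiction e∈b e∉b
      ∂≡0 : ∀ z → z ≢ v → vertexSide z ≡ b → ∂ G a z ≡ 0ℤ
      ∂≡0 z z≢v z∈b with z ≟ v | vertexSide z Bool.≟ b | fay≡0 (inj₂ z)
      ... | yes z≡v | _      | _  = contradiction z≡v z≢v
      ... | no _    | yes _  | eq = eq
      ... | no _    | no z∉b | _  = contradiction z∈b z∉b
      nontrivial : (∃ λ e → a e ≢ 0ℤ) ⊎ (∃ λ z → y z ≢ 0ℤ) → Nontrivial a y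
      nontrivial (inj₁ a≢0)       = inj₁ a≢0
      nontrivial (inj₂ (z , y≢0)) = inj₂ (z , v , λ eq → y≢0 (trans eq yᵥ≡0))

-- Dissipated energy on one side of a separation

opaque
  unfolding ∑

  ∑-nonneg : (t : Fin k → ℤ) → (∀ i → 0ℤ ≤ t i) → 0ℤ ≤ ∑ t
  ∑-nonneg {zero}  t t≥0 = ≤-refl
  ∑-nonneg {suc k} t t≥0 = +-mono-≤ (t≥0 zero) (∑-nonneg (t ∘ suc) (t≥0 ∘ suc))

∑≡0⇒≡0 : (t : Fin k → ℤ) → (∀ i → 0ℤ ≤ t i) → ∑ t ≡ 0ℤ → ∀ i → t i ≡ 0ℤ
∑≡0⇒≡0 {suc k} t t≥0 ∑≡0 i = ≤-antisym (begin
  t i                                 ≡⟨ +-identityʳ (t i) ⟨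
  t i + 0ℤ                            ≤⟨ +-monoʳ-≤ (t i) (∑-nonneg _ λ j → t≥0 (punchIn i j)) ⟩
  t i + ∑[ j ] t (punchIn i j)        ≡⟨ ∑-remove i t ⟨
  ∑ t                                 ≡⟨ ∑≡0 ⟩
  0ℤ                                  ∎) (t≥0 i)
  where open ≤-Reasoning

square-nonneg : ∀ i → 0ℤ ≤ i * i
square-nonneg (+ zero)      = ≤-refl
square-nonneg (+ suc i)     = ℤ.+≤+ z≤n
square-nonneg (ℤ.-[1+ i ])  = ℤ.+≤+ z≤n

module _ {G : Graph n m} {v : Fin (suc n)} (sep : Separation G v) where
  open Separation sep

  -- The energy dissipated on the side not b is zero by summation by parts.

  module _ {b : Bool} {I J K : Subset m} {x a : Fin m → ℤ} {y : Fin (suc n) → ℤ}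
           (I∌ : ∀ e → edgeSide e ≢ b → e ∉ I) (K∌ : ∀ e → edgeSide e ≢ b → e ∉ K)
           (x≥0 : ∀ e → edgeSide e ≢ b → 0ℤ ≤ x e)
           (sol : Solution G I J K x a y) where
    open Solution sol

    private
      drop : Fin m → ℤ
      drop e = y (source G e) - y (target G e)

      weight≡x : ∀ e → edgeSide e ≢ b → weight K x e ≡ x e
      weight≡x e e∉b with e ∈? K
      ... | yes e∈K = contradiction e∈K (K∌ e e∉b)
      ... | no _    = refl

      ohm′ : ∀ e → edgeSide e ≢ b → x e * a e + drop e ≡ 0ℤ
      ohm′ e e∉b = trans (cong (λ w → w * a e + drop e) (sym (weight≡x e e∉b)))
        (ohm e (I∌ e e∉b))

      off : ∀ {c} → c ≢ b → c ≡ not b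
      off = Bool.¬-not

      -- Written as a restricted current times a potential difference, so that summation by parts
      -- applies; off side b it equals x a² by Ohm's law.
      energy : Fin m → ℤ
      energy e = restrict sep (not b) a e * - drop e

      energy-off : ∀ e → edgeSide e ≢ b → energy e ≡ x e * (a e * a e)
      energy-off e e∉b = begin
        restrict sep (not b) a e * - drop e
          ≡⟨ cong (_* - drop e) (restrict-on sep a (off e∉b)) ⟩
        a e * - drop e
          ≡⟨ lemma (a e) (x e) (drop e) ⟩
        x e * (a e * a e) + - (a e * (x e * a e + drop e))
          ≡⟨ cong (λ t → x e * (a e * a e) + - (a e * t)) (ohm′ e e∉b) ⟩
        x e * (a e * a e) + - (a e * 0ℤ)
          ≡⟨ cong (λ t → x e * (a e * a e) + - t) (*-zeroʳ (a e)) ⟩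
        x e * (a e * a e) + 0ℤ
          ≡⟨ +-identityʳ _ ⟩
        x e * (a e * a e) ∎
        where
        open ≡-Reasoning
        lemma : ∀ a x d → a * - d ≡ x * (a * a) + - (a * (x * a + d))
        lemma = solve-∀

      energy-nonneg : ∀ e → 0ℤ ≤ energy e
      energy-nonneg e with edgeSide e Bool.≟ b
      ... | no e∉b  = subst (0ℤ ≤_) (sym (energy-off e e∉b))
        (subst (_≤ x e * (a e * a e)) (*-zeroʳ (x e))
          (*-monoˡ-≤-nonNeg (x e) {{ℤ.nonNegative (x≥0 e e∉b)}} (square-nonneg (a e))))
      ... | yes e∈b = ≤-reflexive (sym (cong (_* - drop e)
        (restrict-off sep a (Bool.not-¬ e∈b))))

      ∑-energy : ∑ energy ≡ 0ℤ
      ∑-energy = begin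
        ∑ energy
          ≡⟨ ∑-cong (λ e → sym (neg-distribʳ-* (restrict sep (not b) a e) (drop e))) ⟩
        ∑[ e ] (- (restrict sep (not b) a e * drop e))
          ≡⟨ ∑-neg (λ e → restrict sep (not b) a e * drop e) ⟩
        - ∑[ e ] (restrict sep (not b) a e * drop e)
          ≡⟨ cong -_ (∑-∂ G (restrict sep (not b) a) y) ⟨
        - ∑[ z ] (y z * ∂ G (restrict sep (not b) a) z)
          ≡⟨ cong -_ (∑-zero λ z → *-vanishʳ (y z)
               (restrict-conserve sep (not b) a conserve z)) ⟩
        0ℤ ∎
        where open ≡-Reasoning

    -- The terms x a² are nonnegative with sum zero, so each of them is zero.
    energy-vanishes : ∀ e → edgeSide e ≢ b → x e ≡ 0ℤ ⊎ a e ≡ 0ℤ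
    energy-vanishes e e∉b
      with i*j≡0⇒i≡0∨j≡0 (x e) (trans (sym (energy-off e e∉b))
             (∑≡0⇒≡0 energy energy-nonneg ∑-energy e))
    ... | inj₁ x≡0 = inj₁ x≡0
    ... | inj₂ aa≡0 with i*j≡0⇒i≡0∨j≡0 (a e) aa≡0
    ...   | inj₁ a≡0 = inj₂ a≡0
    ...   | inj₂ a≡0 = inj₂ a≡0

    -- Off side b the products x a vanish, so by Ohm's law all potential drops there are zero. Zero
    -- currents are then consistent with any resistances x′ on that side.
    restrict-solution : {x′ : Fin m → ℤ} → (∀ e → edgeSide e ≡ b → x e ≡ x′ e) →
                        Solution G I J K x′ (restrict sep b a) y
    restrict-solution {x′} x≡x′ = record
      { support  = λ e e∈J → support′ e (support e e∈J)
      ; ohm      = ohm″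
      ; conserve = restrict-conserve sep b a conserve
      }
      where
      support′ : ∀ e → a e ≡ 0ℤ → restrict sep b a e ≡ 0ℤ
      support′ e a≡0 with edgeSide e Bool.≟ b
      ... | yes _ = a≡0
      ... | no _  = refl
      drop≡0 : ∀ e → edgeSide e ≢ b → drop e ≡ 0ℤ
      drop≡0 e e∉b = trans (sym (+-identityˡ (drop e)))
        (trans (cong (_+ drop e) (sym xa≡0)) (ohm′ e e∉b))
        where
        xa≡0 : x e * a e ≡ 0ℤ
        xa≡0 with energy-vanishes e e∉b
        ... | inj₁ x≡0 = cong (_* a e) x≡0
        ... | inj₂ a≡0 = *-vanishʳ (x e) a≡0
      weight-cong : ∀ e → x e ≡ x′ e → weight K x e ≡ weight K x′ e
      weight-cong e eq with e ∈? K
      ... | yes _ = refl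
      ... | no _  = eq
      ohm″ : ∀ e → e ∉ I → weight K x′ e * restrict sep b a e + drop e ≡ 0ℤ
      ohm″ e e∉I with edgeSide e Bool.≟ b
      ... | yes e∈b = trans (cong (λ w → w * a e + drop e) (sym (weight-cong e (x≡x′ e e∈b))))
        (ohm e e∉I)
      ... | no e∉b  = cong₂ _+_ (*-zeroʳ (weight K x′ e)) (drop≡0 e e∉b)

-- Contraction

identify-image : {s t : Fin (suc n)} (s≢t : s ≢ t) → identify s≢t s ≡ identify s≢t t
identify-image {s = s} {t} s≢t with t ≟ s | t ≟ t
... | yes t≡s | _      = contradiction (sym t≡s) s≢t
... | no _    | no t≢t = contradiction refl t≢t
... | no _    | yes _  = punchOut-cong t refl

identify-injective : {s t : Fin (suc n)} (s≢t : s ≢ t) {u z : Fin (suc n)} →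
                     z ≢ s → z ≢ t → identify s≢t u ≡ identify s≢t z → u ≡ z
identify-injective {t = t} s≢t {u} {z} z≢s z≢t eq with t ≟ u | t ≟ z
... | _      | yes t≡z = contradiction (sym t≡z) z≢t
... | yes _  | no t≢z = contradiction (sym (punchOut-injective (s≢t ∘ sym) t≢z eq)) z≢s
... | no t≢u | no t≢z = punchOut-injective t≢u t≢z eq

identify-surjective : {s t : Fin (suc n)} (s≢t : s ≢ t) (z : Fin n) → ∃ λ u → identify s≢t u ≡ z
identify-surjective {t = t} s≢t z = punchIn t z , image
  where
  image : identify s≢t (punchIn t z) ≡ z
  image with t ≟ punchIn t z
  ... | yes t≡ = contradiction (sym t≡) (punchInᵢ≢i t z)
  ... | no _   = trans (punchOut-cong t refl) (punchOut-punchIn t)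

contracted : (G : Graph (suc n) (suc m)) (e : Fin (suc m)) → source G e ≢ target G e → Graph n m
contracted G e s≢t = record
  { source = identify s≢t ∘ source (delete G e)
  ; target = identify s≢t ∘ target (delete G e)
  }

-- The proof of inequality inside `contract` comes from deciding equality of the ends, so it is
-- returned instead of being compared with the given one.
contract-nonloop : (G : Graph (suc n) (suc m)) (e : Fin (suc m)) → source G e ≢ target G e →
                   ∃ λ s≢t → contract G e ≡ (n , contracted G e s≢t)
contract-nonloop G e s≢t with source G e ≟ target G e
... | yes s≡t = contradiction s≡t s≢t
... | no s≢t′ = s≢t′ , refl

-- Carries edge sets of G / e over to G, with edges renumbered by `punchIn e` as in `delete`.
avoid : Fin (suc m) → Subset m → Subset (suc m)
avoid e X = Vec.insertAt X e outside

avoid-∉ : (e : Fin (suc m)) (X : Subset m) → e ∉ avoid e X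
avoid-∉ e X e∈ = case trans (sym (Vec.insertAt-lookup X e outside)) (Vec.[]=⇒lookup e∈) of λ ()

avoid-∈⁻ : (e : Fin (suc m)) (X : Subset m) {f : Fin m} → punchIn e f ∈ avoid e X → f ∈ X
avoid-∈⁻ e X {f} f∈ = Vec.lookup⇒[]= f X
  (trans (sym (Vec.insertAt-punchIn X e outside f)) (Vec.[]=⇒lookup f∈))

avoid-∈⁺ : (e : Fin (suc m)) (X : Subset m) {f : Fin m} → f ∈ X → punchIn e f ∈ avoid e X
avoid-∈⁺ e X {f} f∈ = Vec.lookup⇒[]= (punchIn e f) (avoid e X)
  (trans (Vec.insertAt-punchIn X e outside f) (Vec.[]=⇒lookup f∈))

avoid-zipWith : (_∙_ : Bool → Bool → Bool) → outside ∙ outside ≡ outside →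
                (e : Fin (suc m)) (X Y : Subset m) →
                Vec.zipWith _∙_ (avoid e X) (avoid e Y) ≡ avoid e (Vec.zipWith _∙_ X Y)
avoid-zipWith _∙_ eq zero    X       Y       = cong (_∷ Vec.zipWith _∙_ X Y) eq
avoid-zipWith _∙_ eq (suc e) (b ∷ X) (c ∷ Y) = cong (_ ∷_) (avoid-zipWith _∙_ eq e X Y)

∣avoid∣ : (e : Fin (suc m)) (X : Subset m) → ∣ avoid e X ∣ ≡ ∣ X ∣
∣avoid∣ zero    X             = refl
∣avoid∣ (suc e) (inside  ∷ X) = cong suc (∣avoid∣ e X)
∣avoid∣ (suc e) (outside ∷ X) = ∣avoid∣ e X

punchIn-cases : (e : Fin (suc m)) (P : Fin (suc m) → Set) →
                P e → (∀ f → P (punchIn e f)) → ∀ g → P g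
punchIn-cases e P Pe P-in g with e ≟ g
... | yes refl = Pe
... | no e≢g   = subst P (punchIn-punchOut e≢g) (P-in (punchOut e≢g))

avoid-empty : (e : Fin (suc m)) (X : Subset m) → Empty X → Empty (avoid e X)
avoid-empty e X X-empty (g , g∈) = punchIn-cases e (_∉ avoid e X) (avoid-∉ e X)
  (λ f f∈ → X-empty (f , avoid-∈⁻ e X f∈)) g g∈

avoid-triple : (e : Fin (suc m)) {S I J K : Subset m} → DodgsonTriple S I J K →
               DodgsonTriple (avoid e S) (avoid e I) (avoid e J) (avoid e K)
avoid-triple e {S} {I} {J} {K} T = record
  { union    = trans (cong (avoid e I ∪_) (∪-avoid J K))
      (trans (∪-avoid I (J ∪ K)) (cong (avoid e) union))
  ; disjoint = subst Empty (sym (trans (cong (avoid e K ∩_) (∪-avoid I J)) (∩-avoid K (I ∪ J))))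
      (avoid-empty e _ disjoint)
  ; balanced = trans (∣avoid∣ e I) (trans balanced (sym (∣avoid∣ e J)))
  ; shape    = case shape of λ where
      (inj₁ (∣I∣ , I∩J , ∣K∣)) → inj₁ (trans (∣avoid∣ e I) ∣I∣ ,
        subst Empty (sym (∩-avoid I J)) (avoid-empty e _ I∩J) , trans (∣avoid∣ e K) ∣K∣)
      (inj₂ (∣I∣ , I∩J , K-empty)) → inj₂ (trans (∣avoid∣ e I) ∣I∣ ,
        trans (cong ∣_∣ (∩-avoid I J)) (trans (∣avoid∣ e (I ∩ J)) I∩J) , avoid-empty e K K-empty)
  }
  where
  open DodgsonTriple T
  ∪-avoid : ∀ X Y → avoid e X ∪ avoid e Y ≡ avoid e (X ∪ Y)
  ∪-avoid = avoid-zipWith _∨_ refl e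
  ∩-avoid : ∀ X Y → avoid e X ∩ avoid e Y ≡ avoid e (X ∩ Y)
  ∩-avoid = avoid-zipWith _∧_ refl e

module _ (G : Graph (suc n) (suc m)) (e : Fin (suc m)) (s≢t : source G e ≢ target G e)
         (I J K : Subset m) where

  private
    G/e = contracted G e s≢t
    s = source G e
    t = target G e
    π = identify s≢t

    incidence-π : ∀ f {z} → z ≢ s → z ≢ t →
                  incidence G/e f (π z) ≡ incidence G (punchIn e f) z
    incidence-π f {z} z≢s z≢t =
      cong₂ _-_ (δ-π (source G (punchIn e f))) (δ-π (target G (punchIn e f)))
      where
      δ-π : ∀ u → δ (π u) (π z) ≡ δ u z
      δ-π u with u ≟ z
      ... | yes refl = δ-refl (π u)
      ... | no u≢z   = δ-≢ (u≢z ∘ identify-injective s≢t z≢s z≢t)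

    weight-avoid : ∀ x f → weight (avoid e K) x (punchIn e f) ≡ weight K (x ∘ punchIn e) f
    weight-avoid x f with punchIn e f ∈? avoid e K | f ∈? K
    ... | yes _  | yes _  = refl
    ... | no _   | no _   = refl
    ... | yes f∈ | no f∉  = contradiction (avoid-∈⁻ e K f∈) f∉
    ... | no f∉  | yes f∈ = contradiction (avoid-∈⁺ e K f∈) f∉

    weight-e : ∀ x → x e ≡ 0ℤ → weight (avoid e K) x e ≡ 0ℤ
    weight-e x x≡0 with e ∈? avoid e K
    ... | yes _ = refl
    ... | no _  = x≡0

  -- Contracting e amounts to α_e = 0.  The current through e is the one
  -- that restores conservation at the target of e.

  uncontract : (x : Fin (suc m) → ℤ) → x e ≡ 0ℤ → Degenerate G/e I J K (x ∘ punchIn e) →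
               ∃₂ λ a y → Solution G (avoid e I) (avoid e J) (avoid e K) x a y
                 × ((∃ λ f → f ≢ e × a f ≢ 0ℤ) ⊎ (∃₂ λ u w → y u ≢ y w))
  uncontract x x≡0 (a′ , y′ , sol′ , nontrivial′) = a , y , record
      { support  = punchIn-cases e (λ g → g ∈ avoid e J → a g ≡ 0ℤ)
          (λ e∈ → contradiction e∈ (avoid-∉ e J))
          (λ f f∈ → trans (a-punchIn f) (Solution.support sol′ f (avoid-∈⁻ e J f∈)))
      ; ohm      = punchIn-cases e
          (λ g → g ∉ avoid e I →
            weight (avoid e K) x g * a g + (y (source G g) - y (target G g)) ≡ 0ℤ)
          -- Ohm's law at e: its resistance is zero and its two ends, identified in G / e, have
          -- equal potential.
          (λ _ → cong₂ _+_ (cong (_* a e) (weight-e x x≡0))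
            (i≡j⇒i-j≡0 {y s} {y t} (cong y′ (identify-image s≢t))))
          (λ f f∉ → trans (cong (_+ (y (source G (punchIn e f)) - y (target G (punchIn e f))))
                      (cong₂ _*_ (weight-avoid x f) (a-punchIn f)))
            (Solution.ohm sol′ f (f∉ ∘ avoid-∈⁺ e I)))
      ; conserve = ∂≡0-except G a s conserve
      } , nontrivial nontrivial′
    where
    flow : Fin (suc (suc n)) → ℤ
    flow z = ∑[ f ] (incidence G (punchIn e f) z * a′ f)
    a : Fin (suc m) → ℤ
    a = Vector.insertAt a′ e (flow t)
    y : Fin (suc (suc n)) → ℤ
    y = y′ ∘ π
    a-e : a e ≡ flow t
    a-e = Vector.insertAt-lookup a′ e (flow t)
    a-punchIn : ∀ f → a (punchIn e f) ≡ a′ f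
    a-punchIn = Vector.insertAt-punchIn a′ e (flow t)
    ∂-a : ∀ z → ∂ G a z ≡ incidence G e z * flow t + flow z
    ∂-a z = trans (∑-remove e λ g → incidence G g z * a g)
      (cong₂ _+_ (cong (incidence G e z *_) a-e)
        (∑-cong λ f → cong (incidence G (punchIn e f) z *_) (a-punchIn f)))
    conserve : ∀ z → z ≢ s → ∂ G a z ≡ 0ℤ
    conserve z z≢s with z ≟ t
    ... | yes refl = trans (∂-a t)
      (trans (cong (λ i → i * flow t + flow t) (cong₂ _-_ (δ-≢ s≢t) (δ-refl t)))
        (lemma (flow t)))
      where
      lemma : ∀ p → ℤ.-1ℤ * p + p ≡ 0ℤ
      lemma = solve-∀
    ... | no z≢t   = trans (∂-a z) (cong₂ _+_
      (cong (_* flow t) (cong₂ _-_ (δ-≢ (z≢s ∘ sym)) (δ-≢ (z≢t ∘ sym))))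
      (trans (∑-cong λ f → cong (_* a′ f) (sym (incidence-π f z≢s z≢t)))
        (Solution.conserve sol′ (π z))))
    -- A nonzero current is found off e, since with x e = 0 the energy gives no control over the
    -- current through e.
    nontrivial : Nontrivial a′ y′ → (∃ λ f → f ≢ e × a f ≢ 0ℤ) ⊎ (∃₂ λ u w → y u ≢ y w)
    nontrivial (inj₁ (f , a′≢0)) = inj₁ (punchIn e f , punchInᵢ≢i e f ,
      λ a≡0 → a′≢0 (trans (sym (a-punchIn f)) a≡0))
    nontrivial (inj₂ (u′ , w′ , y′≢)) with identify-surjective s≢t u′ | identify-surjective s≢t w′
    ... | u , refl | w , refl = inj₂ (u , w , y′≢)

module _ {G : Graph (suc n) (suc m)} {v : Fin (suc (suc n))} (sep : Separation G v) where
  open Separation sep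

  -- Degeneracy of the contraction is only used with unit weights on the
  -- side of e, where solutions are then trivial.

  uncontract-degenerate :
    (e : Fin (suc m)) (s≢t : source G e ≢ target G e) {b : Bool} → edgeSide e ≢ b →
    (I J K : Subset m) →
    (∀ f → edgeSide f ≢ b → f ∉ avoid e I) → (∀ f → edgeSide f ≢ b → f ∉ avoid e K) →
    (∀ x → Degenerate (contracted G e s≢t) I J K x) →
    ∀ x → Degenerate G (avoid e I) (avoid e J) (avoid e K) x
  uncontract-degenerate e s≢t {b} e∉b I J K I∌ K∌ D x =
    extend (uncontract G e s≢t I J K x₀ x₀-e (D (x₀ ∘ punchIn e)))
    where
    -- Zero at e, as contraction demands; the given x on side b, where the currents are kept; and 1
    -- elsewhere, so that zero energy forces zero current.
    x₀ : Fin (suc m) → ℤ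
    x₀ f with f ≟ e | edgeSide f Bool.≟ b
    ... | yes _ | _     = 0ℤ
    ... | no _  | yes _ = x f
    ... | no _  | no _  = 1ℤ
    x₀-e : x₀ e ≡ 0ℤ
    x₀-e with e ≟ e
    ... | yes _  = refl
    ... | no e≢e = contradiction refl e≢e
    x₀≥0 : ∀ f → edgeSide f ≢ b → 0ℤ ≤ x₀ f
    x₀≥0 f f∉b with f ≟ e | edgeSide f Bool.≟ b
    ... | yes _ | _       = ≤-refl
    ... | no _  | yes f∈b = contradiction f∈b f∉b
    ... | no _  | no _    = ℤ.+≤+ z≤n
    x₀≡x : ∀ f → edgeSide f ≡ b → x₀ f ≡ x f
    x₀≡x f f∈b with f ≟ e | edgeSide f Bool.≟ b
    ... | yes refl | _      = contradiction f∈b e∉b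
    ... | no _     | yes _  = refl
    ... | no _     | no f∉b = contradiction f∈b f∉b
    x₀≢0 : ∀ f → f ≢ e → edgeSide f ≢ b → x₀ f ≢ 0ℤ
    x₀≢0 f f≢e f∉b eq with f ≟ e | edgeSide f Bool.≟ b
    ... | yes f≡e | _       = f≢e f≡e
    ... | no _    | yes f∈b = f∉b f∈b
    extend : (∃₂ λ a y → Solution G (avoid e I) (avoid e J) (avoid e K) x₀ a y
               × ((∃ λ f → f ≢ e × a f ≢ 0ℤ) ⊎ (∃₂ λ u w → y u ≢ y w))) →
             Degenerate G (avoid e I) (avoid e J) (avoid e K) x
    extend (a , y , sol , nontrivial) = restrict sep b a , y ,
        restrict-solution sep I∌ K∌ x₀≥0 sol x₀≡x , nontrivial′ nontrivial
      where
      nontrivial′ : _ → Nontrivial (restrict sep b a) y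
      nontrivial′ (inj₂ y≢)              = inj₂ y≢
      nontrivial′ (inj₁ (f , f≢e , a≢0)) with edgeSide f Bool.≟ b
      ... | yes f∈b = inj₁ (f , λ r≡0 → a≢0 (trans (sym (restrict-on sep a f∈b)) r≡0))
      ... | no f∉b with energy-vanishes sep I∌ K∌ x₀≥0 sol f f∉b
      ...   | inj₁ x₀≡0 = contradiction x₀≡0 (x₀≢0 f f≢e f∉b)
      ...   | inj₂ a≡0  = contradiction a≡0 a≢0

-- Choice of a Dodgson triple

∈-∖⁻ : (X : Subset m) (x : Fin m) {e : Fin m} → e ∈ X ∖ x → e ∈ X × e ≢ x
∈-∖⁻ (b ∷ X)      zero    {suc e} (there e∈) = there (subst (e ∈_) (p─⊥≡p X) e∈) , λ ()
∈-∖⁻ (inside ∷ X) (suc x) {zero}  here       = here , λ ()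
∈-∖⁻ (b ∷ X)      (suc x) {suc e} (there e∈) with ∈-∖⁻ X x e∈
... | e∈X , e≢x = there e∈X , e≢x ∘ suc-injective

suc∣∖∣ : (X : Subset m) {x : Fin m} → x ∈ X → suc ∣ X ∖ x ∣ ≡ ∣ X ∣
suc∣∖∣ (inside  ∷ X) here         = cong (suc ∘ ∣_∣) (p─⊥≡p X)
suc∣∖∣ (inside  ∷ X) (there x∈X) = cong suc (suc∣∖∣ X x∈X)
suc∣∖∣ (outside ∷ X) (there x∈X) = suc∣∖∣ X x∈X

pick : (X : Subset m) → ∣ X ∣ ≡ suc k → ∃ λ x → x ∈ X × ∣ X ∖ x ∣ ≡ k
pick {m} X ∣X∣ with nonempty? X
... | yes (x , x∈X) = x , x∈X , ℕ.suc-injective (trans (suc∣∖∣ X x∈X) ∣X∣)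
... | no X-empty    = contradiction
  (trans (sym ∣X∣) (trans (cong ∣_∣ (Empty-unique X-empty)) (∣⊥∣≡0 m))) λ ()

⁅⁆∪∖ : {X : Subset m} {x : Fin m} → x ∈ X → ⁅ x ⁆ ∪ (X ∖ x) ≡ X
⁅⁆∪∖ {X = X} {x} x∈X = ⊆-antisym
  (λ e∈ → case x∈p∪q⁻ ⁅ x ⁆ (X ∖ x) e∈ of λ where
    (inj₁ e∈x) → subst (_∈ X) (sym (x∈⁅y⁆⇒x≡y x e∈x)) x∈X
    (inj₂ e∈-) → proj₁ (∈-∖⁻ X x e∈-))
  λ {e} e∈X → split e e∈X
  where
  split : ∀ e → e ∈ X → e ∈ ⁅ x ⁆ ∪ (X ∖ x)
  split e e∈X with e ≟ x
  ... | yes refl = x∈p∪q⁺ (inj₁ (x∈⁅x⁆ x))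
  ... | no e≢x   = x∈p∪q⁺ {p = ⁅ x ⁆} (inj₂ (x∈p∧x≢y⇒x∈p-y e∈X e≢x))

∈-pair⁻ : {x y e : Fin m} → e ∈ ⁅ x ⁆ ∪ ⁅ y ⁆ → e ≡ x ⊎ e ≡ y
∈-pair⁻ {x = x} {y} e∈ with x∈p∪q⁻ ⁅ x ⁆ ⁅ y ⁆ e∈
... | inj₁ e∈x = inj₁ (x∈⁅y⁆⇒x≡y x e∈x)
... | inj₂ e∈y = inj₂ (x∈⁅y⁆⇒x≡y y e∈y)

∈-pairˡ : (x y : Fin m) → x ∈ ⁅ x ⁆ ∪ ⁅ y ⁆
∈-pairˡ x y = x∈p∪q⁺ (inj₁ (x∈⁅x⁆ x))

∈-pairʳ : (x y : Fin m) → y ∈ ⁅ x ⁆ ∪ ⁅ y ⁆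
∈-pairʳ x y = x∈p∪q⁺ {p = ⁅ x ⁆} (inj₂ (x∈⁅x⁆ y))

∣pair∣ : {x y : Fin m} → x ≢ y → ∣ ⁅ x ⁆ ∪ ⁅ y ⁆ ∣ ≡ 2
∣pair∣ {x = x} {y} x≢y = trans (sym (suc∣∖∣ (⁅ x ⁆ ∪ ⁅ y ⁆) (∈-pairˡ x y)))
  (cong suc (trans (cong ∣_∣ rest) (∣⁅x⁆∣≡1 y)))
  where
  to : ∀ {e} → e ∈ (⁅ x ⁆ ∪ ⁅ y ⁆) ∖ x → e ∈ ⁅ y ⁆
  to e∈ with ∈-∖⁻ (⁅ x ⁆ ∪ ⁅ y ⁆) x e∈
  ... | e∈xy , e≢x with ∈-pair⁻ e∈xy
  ...   | inj₁ e≡x  = contradiction e≡x e≢x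
  ...   | inj₂ refl = x∈⁅x⁆ _
  rest : (⁅ x ⁆ ∪ ⁅ y ⁆) ∖ x ≡ ⁅ y ⁆
  rest = ⊆-antisym to λ e∈y → case x∈⁅y⁆⇒x≡y y e∈y of λ where
    refl → x∈p∧x≢y⇒x∈p-y (∈-pairʳ x y) (x≢y ∘ sym)

∉-pair : (X : Subset m) {p q e : Fin m} → e ∈ X ∖ p ∖ q → e ∉ ⁅ p ⁆ ∪ ⁅ q ⁆
∉-pair X {p} {q} e∈ e∈pq with ∈-∖⁻ (X ∖ p) q e∈
... | e∈- , e≢q with ∈-pair⁻ e∈pq
...   | inj₁ e≡p = proj₂ (∈-∖⁻ X p e∈-) e≡p
...   | inj₂ e≡q = e≢q e≡q

pairs-disjoint : (X : Subset m) {p q r s e : Fin m} → r ∈ X ∖ p ∖ q → s ∈ X ∖ p ∖ q ∖ r →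
                 e ∈ ⁅ p ⁆ ∪ ⁅ q ⁆ → e ∉ ⁅ r ⁆ ∪ ⁅ s ⁆
pairs-disjoint X {p} {q} {r} r∈ s∈ e∈pq e∈rs with ∈-pair⁻ e∈rs
... | inj₁ refl = ∉-pair X r∈ e∈pq
... | inj₂ refl = ∉-pair X (proj₁ (∈-∖⁻ (X ∖ p ∖ q) r s∈)) e∈pq

-- Ψ^{pq,rs}_t, where t is the remaining edge of S

triple : (S : Subset m) → ∣ S ∣ ≡ 5 → {p q r s : Fin m} →
         p ∈ S → q ∈ S ∖ p → r ∈ S ∖ p ∖ q → s ∈ S ∖ p ∖ q ∖ r →
         DodgsonTriple S (⁅ p ⁆ ∪ ⁅ q ⁆) (⁅ r ⁆ ∪ ⁅ s ⁆) (S ∖ p ∖ q ∖ r ∖ s)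
triple S ∣S∣ {p} {q} {r} {s} p∈ q∈ r∈ s∈ = record
  { union    = begin
      (⁅ p ⁆ ∪ ⁅ q ⁆) ∪ (⁅ r ⁆ ∪ ⁅ s ⁆) ∪ (S ∖ p ∖ q ∖ r ∖ s)
        ≡⟨ cong ((⁅ p ⁆ ∪ ⁅ q ⁆) ∪_) (∪-assoc ⁅ r ⁆ ⁅ s ⁆ _) ⟩
      (⁅ p ⁆ ∪ ⁅ q ⁆) ∪ ⁅ r ⁆ ∪ ⁅ s ⁆ ∪ (S ∖ p ∖ q ∖ r ∖ s)
        ≡⟨ cong (λ X → (⁅ p ⁆ ∪ ⁅ q ⁆) ∪ ⁅ r ⁆ ∪ X) (⁅⁆∪∖ s∈) ⟩
      (⁅ p ⁆ ∪ ⁅ q ⁆) ∪ ⁅ r ⁆ ∪ (S ∖ p ∖ q ∖ r)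
        ≡⟨ cong ((⁅ p ⁆ ∪ ⁅ q ⁆) ∪_) (⁅⁆∪∖ r∈) ⟩
      (⁅ p ⁆ ∪ ⁅ q ⁆) ∪ (S ∖ p ∖ q)
        ≡⟨ ∪-assoc ⁅ p ⁆ ⁅ q ⁆ _ ⟩
      ⁅ p ⁆ ∪ ⁅ q ⁆ ∪ (S ∖ p ∖ q)
        ≡⟨ cong (⁅ p ⁆ ∪_) (⁅⁆∪∖ q∈) ⟩
      ⁅ p ⁆ ∪ (S ∖ p)
        ≡⟨ ⁅⁆∪∖ p∈ ⟩
      S ∎
  ; disjoint = λ { (e , e∈) → disjoint (x∈p∩q⁻ _ _ e∈) }
  ; balanced = trans ∣pq∣ (sym (∣pair∣ (≢-sym s≢r)))
  ; shape    = inj₁ (∣pq∣ , (λ { (e , e∈) → I∩J (x∈p∩q⁻ _ _ e∈) }) , ∣K∣)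
  }
  where
  open ≡-Reasoning
  q≢p = proj₂ (∈-∖⁻ S p q∈)
  s≢r = proj₂ (∈-∖⁻ (S ∖ p ∖ q) r s∈)
  ∣pq∣ : ∣ ⁅ p ⁆ ∪ ⁅ q ⁆ ∣ ≡ 2
  ∣pq∣ = ∣pair∣ (≢-sym q≢p)
  I∩J : ∀ {e} → e ∈ ⁅ p ⁆ ∪ ⁅ q ⁆ × e ∈ ⁅ r ⁆ ∪ ⁅ s ⁆ → ⊥
  I∩J (e∈pq , e∈rs) = pairs-disjoint S r∈ s∈ e∈pq e∈rs
  disjoint : ∀ {e} → e ∈ S ∖ p ∖ q ∖ r ∖ s × e ∈ (⁅ p ⁆ ∪ ⁅ q ⁆) ∪ (⁅ r ⁆ ∪ ⁅ s ⁆) → ⊥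
  disjoint (e∈K , e∈IJ) with ∈-∖⁻ (S ∖ p ∖ q ∖ r) s e∈K
  ... | e∈-r , e≢s with ∈-∖⁻ (S ∖ p ∖ q) r e∈-r | x∈p∪q⁻ (⁅ p ⁆ ∪ ⁅ q ⁆) (⁅ r ⁆ ∪ ⁅ s ⁆) e∈IJ
  ...   | e∈-q , _   | inj₁ e∈pq = ∉-pair S e∈-q e∈pq
  ...   | _    , e≢r | inj₂ e∈rs = [ e≢r , e≢s ] (∈-pair⁻ e∈rs)
  ∣K∣ : ∣ S ∖ p ∖ q ∖ r ∖ s ∣ ≡ 1
  ∣K∣ = ℕ.suc-injective (ℕ.suc-injective (ℕ.suc-injective (ℕ.suc-injective
    (begin
      4 ℕ.+ ∣ S ∖ p ∖ q ∖ r ∖ s ∣  ≡⟨ cong (3 ℕ.+_) (suc∣∖∣ (S ∖ p ∖ q ∖ r) s∈) ⟩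
      3 ℕ.+ ∣ S ∖ p ∖ q ∖ r ∣      ≡⟨ cong (2 ℕ.+_) (suc∣∖∣ (S ∖ p ∖ q) r∈) ⟩
      2 ℕ.+ ∣ S ∖ p ∖ q ∣          ≡⟨ cong (1 ℕ.+_) (suc∣∖∣ (S ∖ p) q∈) ⟩
      1 ℕ.+ ∣ S ∖ p ∣              ≡⟨ suc∣∖∣ S p∈ ⟩
      ∣ S ∣                        ≡⟨ ∣S∣ ⟩
      5                            ∎))))

-- Cut vertices: the trivial case and separations

∣∁⁅v⁆∣ : (v : Fin (suc n)) → ∣ ∁ ⁅ v ⁆ ∣ ≡ n
∣∁⁅v⁆∣ {n} v = trans (∣∁p∣≡n∸∣p∣ ⁅ v ⁆) (cong (suc n ℕ.∸_) (∣⁅x⁆∣≡1 v))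

onlyOther : n ℕ.≤ 1 → (v : Fin (suc n)) → ∃ λ z₀ → ∀ z → z ≢ v → z ≡ z₀
-- Here v is the only vertex, and serves as a default for z₀.
onlyOther {zero}        _ zero       = zero , λ { zero _ → refl }
onlyOther {suc zero}    _ zero       = suc zero , λ where
  zero       z≢v → contradiction refl z≢v
  (suc zero) _   → refl
onlyOther {suc zero}    _ (suc zero) = zero , λ where
  zero       _   → refl
  (suc zero) z≢v → contradiction refl z≢v
onlyOther {suc (suc n)} (ℕ.s≤s ())

-- Any four edges of S serve: p and q form I and carry the current, r and s form J.
trivial-splits : (G : Graph n m) (v : Fin (suc n)) → ∣ ∁ ⁅ v ⁆ ∣ ℕ.≤ 1 → Splits G
trivial-splits {n} G v small S ∣S∣
  with onlyOther (subst (ℕ._≤ 1) (∣∁⁅v⁆∣ v) small) v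
... | z₀ , only with pick S ∣S∣
... | p , p∈ , ∣S-p∣ with pick (S ∖ p) ∣S-p∣
... | q , q∈ , ∣S-pq∣ with pick (S ∖ p ∖ q) ∣S-pq∣
... | r , r∈ , ∣S-pqr∣ with pick (S ∖ p ∖ q ∖ r) ∣S-pqr∣
... | s , s∈ , _ = splits-degenerate G (triple S ∣S∣ p∈ q∈ r∈ s∈)
  (twoVertices-degenerate G _ _ _ v z₀ only
    (≢-sym (proj₂ (∈-∖⁻ S p q∈))) (∈-pairˡ p q) (∈-pairʳ p q)
    (pairs-disjoint S r∈ s∈ (∈-pairˡ p q)) (pairs-disjoint S r∈ s∈ (∈-pairʳ p q)))

-- The existence of a separation is only needed to reach a contradiction,
-- so reachability may be assumed to be decidable.

¬¬-separation : (G : Graph n m) (v : Fin (suc n)) →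
                ¬ InducedConnected G (∁ ⁅ v ⁆) → ¬ ¬ Separation G v
¬¬-separation {n} G v disconnected no-separation =
  -- Double negation commutes with conjunctions over finitely many vertices, so reachability may be
  -- assumed decidable for all pairs at once.
  sequence rawApplicative
    (λ u → sequence rawApplicative λ w → ¬¬-excluded-middle {A = Star Adjacent[ G , ∁ ⁅ v ⁆ ] u w})
    λ reachable? → disconnected (connected reachable?)
  where
  open RawMonad ¬¬-Monad using (rawApplicative)
  connected : (∀ u w → Dec (Star Adjacent[ G , ∁ ⁅ v ⁆ ] u w)) → InducedConnected G (∁ ⁅ v ⁆)
  connected reachable? {u} {w} u∈ w∈ with reachable? u w in unreachable
  ... | yes path = path
  ... | no _     = contradiction sep no-separation
    where
    ∈V-v : ∀ {z} → z ≢ v → z ∈ ∁ ⁅ v ⁆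
    ∈V-v z≢v = x∉p⇒x∈∁p (x≢y⇒x∉⁅y⁆ z≢v)
    ≢v : ∀ {z} → z ∈ ∁ ⁅ v ⁆ → z ≢ v
    ≢v z∈ refl = x∈∁p⇒x∉p z∈ (x∈⁅x⁆ v)
    -- One side is the component of u in G - v; the unreachable w lies on the other.
    side : Fin (suc n) → Bool
    side z = does (reachable? u z)
    step : ∀ {z z′} → Adjacent[ G , ∁ ⁅ v ⁆ ] z z′ →
           Adjacent[ G , ∁ ⁅ v ⁆ ] z′ z → side z ≡ side z′
    step {z} {z′} zz′ z′z with reachable? u z | reachable? u z′
    ... | yes _  | yes _  = refl
    ... | no _   | no _   = refl
    ... | yes uz | no ¬uz′ = contradiction (uz ◅◅ zz′ ◅ ε) ¬uz′
    ... | no ¬uz | yes uz′ = contradiction (uz′ ◅◅ z′z ◅ ε) ¬uz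
    -- An edge out of v takes the side of its target, and a loop at v the side that happens to be
    -- assigned to v.
    edgeSide : ∀ e → Dec (source G e ≡ v) → Bool
    edgeSide e (yes _) = side (target G e)
    edgeSide e (no _)  = side (source G e)
    sep : Separation G v
    sep = record
      { vertexSide  = side
      ; edgeSide    = λ e → edgeSide e (source G e ≟ v)
      ; source-side = source-side
      ; target-side = target-side
      ; occupied    = λ where
          true  → u , ≢v u∈ , reachable-u
          false → w , ≢v w∈ , cong does unreachable
      }
      where
      source-side : ∀ e → source G e ≢ v → side (source G e) ≡ edgeSide e (source G e ≟ v)
      source-side e s≢v with source G e ≟ v
      ... | yes s≡v = contradiction s≡v s≢v
      ... | no _    = refl
      target-side : ∀ e → target G e ≢ v → side (target G e) ≡ edgeSide e (source G e ≟ v)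
      target-side e t≢v with source G e ≟ v
      ... | yes _  = refl
      ... | no s≢v = step
        (∈V-v t≢v , ∈V-v s≢v , e , inj₂ (refl , refl))
        (∈V-v s≢v , ∈V-v t≢v , e , inj₁ (refl , refl))
      reachable-u : side u ≡ true
      reachable-u with reachable? u u
      ... | yes _  = refl
      ... | no ¬uu = contradiction ε ¬uu

-- Splitting across a separation

module _ {G : Graph n m} {v : Fin (suc n)} (sep : Separation G v) where
  open Separation sep

  -- A walk from z to v has to leave z, and the first step that does so is a nonloop on the side of
  -- z.
  nonloop : ∀ {z z′} → Star Adjacent[ G , full ] z z′ → z′ ≡ v → z ≢ v →
            ∃ λ e → source G e ≢ target G e × edgeSide e ≡ vertexSide z
  nonloop ε z≡v z≢v = contradiction z≡v z≢v
  nonloop {z} (_◅_ {j = z″} (_ , _ , e , joins) path) z′≡v z≢v with z ≟ z″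
  ... | yes refl = nonloop path z′≡v z≢v
  ... | no z≢z″ with joins
  ...   | inj₁ (refl , refl) = e , z≢z″ , sym (source-side e z≢v)
  ...   | inj₂ (refl , refl) = e , z≢z″ ∘ sym , sym (target-side e z≢v)

  -- Pigeonhole for three edges and two sides: if e differs from both f and g, these two agree.
  monochromaticPair : (X : Subset m) → ∣ X ∣ ≡ 3 →
                      ∃₂ λ r s → r ∈ X × s ∈ X ∖ r × edgeSide r ≡ edgeSide s
  monochromaticPair X ∣X∣ with pick X ∣X∣
  ... | e , e∈ , ∣X-e∣ with pick (X ∖ e) ∣X-e∣
  ... | f , f∈ , ∣X-ef∣ with pick (X ∖ e ∖ f) ∣X-ef∣
  ... | g , g∈ , _
    with ∈-∖⁻ (X ∖ e) f g∈ | edgeSide e Bool.≟ edgeSide f | edgeSide e Bool.≟ edgeSide g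
  ... | _          | yes e~f | _       = e , f , e∈ , f∈ , e~f
  ... | g∈-  , _   | no _    | yes e~g = e , g , e∈ , g∈- , e~g
  ... | g∈-  , g≢f | no e≁f  | no e≁g  = f , g , proj₁ (∈-∖⁻ X e f∈)
      , x∈p∧x≢y⇒x∈p-y (proj₁ (∈-∖⁻ X e g∈-)) g≢f
      , trans (Bool.¬-not (e≁f ∘ sym)) (sym (Bool.¬-not (e≁g ∘ sym)))

  -- Take I = {p, q}, which meets both sides, and for J two of the other three edges that share a
  -- side. One of p and q is then on the side without J, where the equations are too few.
  bichromatic-splits : (S : Subset m) → ∣ S ∣ ≡ 5 → {p q : Fin m} → p ∈ S → q ∈ S →
                       edgeSide p ≢ edgeSide q → ConfigurationSplits G S
  bichromatic-splits S ∣S∣ {p} {q} p∈ q∈ p≁q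
    with monochromaticPair (S ∖ p ∖ q) (size (x∈p∧x≢y⇒x∈p-y q∈ λ { refl → p≁q refl }))
    where
    size : q ∈ S ∖ p → ∣ S ∖ p ∖ q ∣ ≡ 3
    size q∈- = ℕ.suc-injective (trans (suc∣∖∣ (S ∖ p) q∈-)
      (ℕ.suc-injective (trans (suc∣∖∣ S p∈) ∣S∣)))
  ... | r , s , r∈ , s∈ , r~s = splits-degenerate G
      (triple S ∣S∣ p∈ (x∈p∧x≢y⇒x∈p-y q∈ λ { refl → p≁q refl }) r∈ s∈)
      degenerate
    where
    I = ⁅ p ⁆ ∪ ⁅ q ⁆
    J = ⁅ r ⁆ ∪ ⁅ s ⁆
    side-J : ∀ e → e ∈ J → edgeSide e ≡ edgeSide r
    side-J e e∈J with ∈-pair⁻ e∈J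
    ... | inj₁ refl = refl
    ... | inj₂ refl = sym r~s
    degenerate : ∀ x → Degenerate G I J (S ∖ p ∖ q ∖ r ∖ s) x
    degenerate with edgeSide p Bool.≟ edgeSide r
    ... | no p≁r  = unbalanced-degenerate sep I J _ (∈-pairˡ p q)
      λ e e∈J e~p → p≁r (trans (sym e~p) (side-J e e∈J))
    ... | yes p~r = unbalanced-degenerate sep I J _ (∈-pairʳ p q)
      λ e e∈J e~q → p≁q (trans p~r (trans (sym (side-J e e∈J)) e~q))

-- No edge of S is on the side of e, so e ∉ S and S comes from a configuration of G / e. The sets I
-- and K found there lie in S, hence on the other side, as `uncontract-degenerate` requires.
contraction-splits :
  (G : Graph (suc n) (suc m)) {v : Fin (suc (suc n))} (sep : Separation G v)
  (e : Fin (suc m)) (s≢t : source G e ≢ target G e) (S : Subset (suc m)) → ∣ S ∣ ≡ 5 →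
  (∀ f → f ∈ S → Separation.edgeSide sep f ≢ Separation.edgeSide sep e) →
  Splits (contracted G e s≢t) → ConfigurationSplits G S
contraction-splits {m = m} G sep e s≢t S ∣S∣ S≁e splits =
  lift (splits S/e (trans (sym (∣avoid∣ e S/e)) (trans (cong ∣_∣ avoid-S/e) ∣S∣)))
  where
  open Separation sep
  S/e = Vec.removeAt S e
  e∉S : lookup S e ≡ outside
  e∉S with lookup S e in eq
  ... | outside = refl
  ... | inside  = contradiction refl (S≁e e (Vec.lookup⇒[]= e S eq))
  avoid-S/e : avoid e S/e ≡ S
  avoid-S/e = trans (cong (Vec.insertAt S/e e) (sym e∉S)) (Vec.insertAt-removeAt S e)
  lift : ConfigurationSplits (contracted G e s≢t) S/e → ConfigurationSplits G S
  lift (I , J , K , T , Ψ≡0) = subst (ConfigurationSplits G) avoid-S/e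
    (splits-degenerate G (avoid-triple e T)
      (uncontract-degenerate sep e s≢t (Bool.not-¬ refl) I J K
        (λ f f≁ → f≁ ∘ side ∘ ∈S ∘ x∈p∪q⁺ ∘ inj₁)
        (λ f f≁ → f≁ ∘ side ∘ ∈S ∘ x∈p∪q⁺ {p = avoid e I} ∘ inj₂ ∘ x∈p∪q⁺ {p = avoid e J} ∘ inj₂)
        λ x → dodgson≡0⇒degenerate (contracted G e s≢t) I J K x balanced
          (eval-isZero x (dodgson (contracted G e s≢t) I J K balanced) Ψ≡0)))
    where
    open DodgsonTriple T
    ∈S : ∀ {f} → f ∈ avoid e I ∪ avoid e J ∪ avoid e K → f ∈ S
    ∈S {f} = subst (f ∈_) (trans (DodgsonTriple.union (avoid-triple e T)) avoid-S/e)
    side : ∀ {f} → f ∈ S → edgeSide f ≡ not (edgeSide e)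
    side {f} f∈S = Bool.¬-not (S≁e f f∈S)

contract-splits :
  (G : Graph n m) {v : Fin (suc n)} (sep : Separation G v) (e : Fin m) →
  source G e ≢ target G e → (S : Subset m) → ∣ S ∣ ≡ 5 →
  (∀ f → f ∈ S → Separation.edgeSide sep f ≢ Separation.edgeSide sep e) →
  Splits (proj₂ (contract G e)) → ConfigurationSplits G S
contract-splits {zero} {m} G sep e s≢t = contradiction (only-vertex (source G e) (target G e)) s≢t
  where
  only-vertex : (u w : Fin 1) → u ≡ w
  only-vertex zero zero = refl
contract-splits {suc n} {suc m} G sep e s≢t S ∣S∣ S≁e splits with contract-nonloop G e s≢t
... | s≢t′ , eq = contraction-splits G sep e s≢t′ S ∣S∣ S≁e
  (subst (λ G/e → Splits (proj₂ G/e)) eq splits)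

separated-splits : (G : Graph n m) → Connected G → (∀ e → Splits (proj₂ (contract G e))) →
                   ∀ {v} → Separation G v → Splits G
separated-splits G connected minors {v} sep S ∣S∣ with pick S ∣S∣
... | p , p∈ , _
  with any? (λ q → (q ∈? S) ×-dec ¬? (Separation.edgeSide sep p Bool.≟ Separation.edgeSide sep q))
... | yes (q , q∈ , p≁q) = bichromatic-splits sep S ∣S∣ p∈ q∈ p≁q
... | no monochromatic   = otherSide (occupied (not (edgeSide p)))
  where
  open Separation sep
  S~p : ∀ f → f ∈ S → edgeSide p ≡ edgeSide f
  S~p f f∈S = decidable-stable (edgeSide p Bool.≟ edgeSide f) λ p≁f → monochromatic (f , f∈S , p≁f)
  otherSide : (∃ λ z → z ≢ v × vertexSide z ≡ not (edgeSide p)) → ConfigurationSplits G S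
  -- S lies on the side of p. Connectedness gives a walk to v from a vertex of the opposite side,
  -- and thus a nonloop there to contract.
  otherSide (z , z≢v , z≁p) with nonloop sep (connected {z} {v} ∈⊤ ∈⊤) refl z≢v
  ... | e , s≢t , e~z = contract-splits G sep e s≢t S ∣S∣
    (λ f f∈S f~e → Bool.not-¬ refl (trans (S~p f f∈S) (trans f~e (trans e~z z≁p))))
    (minors e)

theorem25 : ∀ {n m : ℕ} (G : Graph n m) → Connected G → MinorMinimalNonSplitting G → ¬ (∃ λ v → IsCutVertex G v)
theorem25 G connected ((S , ∣S∣ , ¬splits) , minors) (v , inj₁ disconnected) =
  -- The goal is a contradiction, so a doubly negated separation is enough.
  ¬¬-separation G v disconnected λ sep →
    ¬splits (separated-splits G connected (λ e → proj₂ (minors e)) sep S ∣S∣)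
theorem25 G connected ((S , ∣S∣ , ¬splits) , minors) (v , inj₂ trivial) =
  ¬splits (trivial-splits G v trivial S ∣S∣)
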